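{- Let $k\ge 2$ be an integer and let $\varepsilon_1,\dots,\varepsilon_{k-1}\in\{ -1,1\}$. Then the set of positive integers $n$ for which \[ \varepsilon_1(\phi(n+1)-\phi(n+2)) > 0,\quad \varepsilon_2(\phi(n+2)-\phi(n+3)) > 0,\quad \dots,\quad \varepsilon_{k-1}(\phi(n+k-1)-\phi(n+k)) > 0 \] all hold has positive lower density.
   Context: $\phi$ denotes the Euler phi-function. The lower density of a set $S$ of positive integers is $\liminf_{x\to\infty} \frac1x\#\{n\in S: n\le x\}$. -}

module Defs where

open import Data.Fin.Base using (Fin; toℕ)
import Data.Fin.Properties as Fin
open import Data.Integer.Base as ℤ using (ℤ; +_; 0ℤ)
import Data.Integer.Properties as ℤ
open import Data.List.Base using (List; filter; length; map; upTo)
open import Data.Nat.Base using (ℕ; suc; _+_; _∸_; _≤_; NonZero)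
open import Data.Nat.Coprimality using (coprime?)
open import Data.Product.Base using (_×_; ∃-syntax)
open import Data.Rational.Base as ℚ using (ℚ; 0ℚ; _/_)
open import Level using (0ℓ)
open import Relation.Unary using (Pred; Decidable; _∈_)

[1⋯_] : ℕ → List ℕ
[1⋯ n ] = map suc (upTo n)

count : {S : Pred ℕ 0ℓ} → Decidable S → ℕ → ℕ
count S? x = length (filter S? [1⋯ x ])

φ : ℕ → ℕ
φ n = count (λ m → coprime? m n) n

-- The limit inferior, as x → ∞, of a sequence indexed by the positive
-- integers.  As a (possibly infinite) real number it is represented by its
-- lower cut: q ∈ liminf a  means  q < lim inf a(x).  The strict inequality
-- q < r is what makes the cut open; merely having q < a(x) for all large x
-- would give only q ≤ lim inf a(x).
liminf : ((x : ℕ) .{{_ : NonZero x}} → ℚ) → Pred ℚ 0ℓ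
liminf a q = ∃[ r ] (q ℚ.< r × ∃[ N ] (∀ x .{{_ : NonZero x}} → N ≤ x → r ℚ.≤ a x))

proportion : {S : Pred ℕ 0ℓ} → Decidable S → (x : ℕ) .{{_ : NonZero x}} → ℚ
proportion S? x = + count S? x / x

-- Only the positive elements of S are counted.  Letting x run over the
-- positive reals instead of the positive integers gives the same value, since
-- the count depends only on ⌊x⌋ and ⌊x⌋/x → 1.
lowerDensity : {S : Pred ℕ 0ℓ} → Decidable S → Pred ℚ 0ℓ
lowerDensity S? = liminf (proportion S?)

HasPositiveLowerDensity : {S : Pred ℕ 0ℓ} → Decidable S → Set
HasPositiveLowerDensity S? = 0ℚ ∈ lowerDensity S?

-- ε is indexed from 0, so that  ε i  is the (i+1)-st sign and goes with the
-- pair  n+(i+1), n+(i+2).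
HasPattern : (k : ℕ) → (Fin (k ∸ 1) → ℤ) → Pred ℕ 0ℓ
HasPattern k ε n = ∀ i →
  ε i ℤ.* (+ φ (n + suc (toℕ i)) ℤ.- + φ (n + suc (suc (toℕ i)))) ℤ.> 0ℤ

hasPattern? : ∀ k ε → Decidable (HasPattern k ε)
hasPattern? k ε n = Fin.all? λ i → 0ℤ ℤ.<? _

{-# OPTIONS --safe #-}
module Submission where

-- The idea is to force the pattern by small values of φ(m)/m.  Suppose numbers
-- q 0, …, q (k-1) are given such that n + i + 1 is divisible by q i and every
-- other prime factor of n + i + 1 either divides i + 1 or is large.  Then
-- φ(n+i+1)/(n+i+1) is at most φ(q i)/q i.  On the other hand, if the large primes
-- contribute little, it is at least 1/(2 d i), where d i = (i+1) q i.  If the q i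
-- are pairwise coprime and their ratios φ(q i)/q i are of widely different orders
-- of magnitude, arranged in the right order, these crude bounds decide every
-- comparison (φ-compare).
--
-- Such q i exist because φ(Q)/Q can be made arbitrarily small with Q coprime to
-- any given N (smallTotientRatio).  This rests on the divergence of the sum of
-- 1/(1 + N j): for distinct divisors n j of Q, the sets of numbers n j b with b
-- coprime to Q are disjoint and have densities φ(Q)/(Q n j), so that the sum of
-- the 1/n j times φ(Q)/Q is at most 1.  Iterating yields a rapidly decreasing
-- sequence of ratios (RapidSequence), and q i is the term whose index is the i-th
-- of a sequence of integers that rises and falls as prescribed (Levels).  The
-- Chinese remainder theorem provides a progression n = n₀ + D t in which q i
-- divides n + i + 1 for all i < k and z ! divides n (patternProgression).
--
-- The lower bound for φ holds for most members of the progression.  Put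
-- m = n + i + 1 = d M with d = d i.  Among the M numbers a = 1 + d s up to m, one
-- that is not coprime to m has in common with m a prime e, which does not divide
-- d and hence does not divide D, so that e > z (totient-lower).  The number of
-- these a is thus, up to a constant factor, at most M times the sum of 1/e over
-- the primes e of this kind dividing m.  On average over a long window of the
-- progression this sum is of the order of the sum of 1/e² over e > z, that is, of
-- the order of 1/z.  For z a large multiple of k,
-- only a fraction 1/(2k) of the window violates φ(m) ≥ M/2 (fewBad), whence at
-- least half of the window satisfies all k lower bounds at once (frequent).

open import Defs
open import Data.Bool.Base using (Bool; true; false; if_then_else_)
open import Data.Empty using (⊥-elim)
open import Data.Fin.Base using (Fin; toℕ)
import Data.Fin.Properties as Fin
open import Data.Integer.Base as ℤ using (ℤ; 0ℤ; 1ℤ; -1ℤ)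
import Data.Integer.Properties as ℤ
open import Data.List.Base using ([]; _∷_; _++_; filter; length; map; upTo)
open import Data.List.Properties using (map-++; filter-++; length-++; upTo-∷ʳ)
import Data.List.Relation.Unary.All as All
open import Data.Nat.Base
open import Data.Nat.Coprimality as Coprime
  using (Coprime; coprime?; coprime-divisor; coprime-Bézout; gcd≡1⇒coprime; 1-coprimeTo)
open import Data.Nat.DivMod
  using (m*n/n≡m; m*[n/m]≡n; m/n*n≤m; m≡m%n+[m/n]*n; m%n<n; /-monoˡ-≤)
open import Data.Nat.Divisibility
open import Data.Nat.GCD using (gcd; gcd[m,n]∣m; gcd[m,n]∣n; gcd[m,n]≢0; module Bézout)
open import Data.Nat.Primality
  using (Prime; prime?; prime⇒irreducible; prime⇒nonZero; euclidsLemma; ¬prime[1])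
open import Data.Nat.Primality.Factorisation using (factorise)
open import Data.Nat.Properties
open import Data.Nat.Tactic.RingSolver using (solve)
open import Data.Product.Base using (_×_; _,_; ∃-syntax; proj₁; proj₂)
open import Data.Rational.Base as ℚ using (toℚᵘ)
import Data.Rational.Properties as ℚ
open import Data.Rational.Unnormalised.Base using (mkℚᵘ; *≤*)
import Data.Rational.Unnormalised.Properties as ℚᵘ
open import Data.Sum.Base using (_⊎_; inj₁; inj₂)
open import Function.Base using (_∘_)
open import Level using (0ℓ)
open import Relation.Binary.Definitions using (tri<; tri≈; tri>)
open import Relation.Binary.PropositionalEquality
  using (_≡_; _≢_; refl; sym; trans; cong; cong₂; subst; module ≡-Reasoning)
open import Relation.Nullary.Decidable
  using (Dec; yes; no; does; ¬?; _×-dec_; dec-true; dec-false)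
open import Relation.Nullary.Negation.Core using (¬_)
open import Relation.Unary using (Pred; Decidable)

-- Finite sums and counting

-- The sum of f i over i < n.
∑ : ℕ → (ℕ → ℕ) → ℕ
∑ zero    f = 0
∑ (suc n) f = ∑ n f + f n

-- The indicator of a decidable proposition.
𝟙 : {P : Set} → Dec P → ℕ
𝟙 (yes _) = 1
𝟙 (no  _) = 0

∑-mono : ∀ n {f g} → (∀ i → i < n → f i ≤ g i) → ∑ n f ≤ ∑ n g
∑-mono zero    h = z≤n
∑-mono (suc n) h = +-mono-≤ (∑-mono n λ i i<n → h i (m<n⇒m<1+n i<n)) (h n ≤-refl)

∑-cong : ∀ n {f g} → (∀ i → f i ≡ g i) → ∑ n f ≡ ∑ n g
∑-cong zero    h = refl
∑-cong (suc n) h = cong₂ _+_ (∑-cong n h) (h n)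

∑-+ : ∀ n f g → ∑ n (λ i → f i + g i) ≡ ∑ n f + ∑ n g
∑-+ zero    f g = refl
∑-+ (suc n) f g = begin
  ∑ n (λ i → f i + g i) + (f n + g n)  ≡⟨ cong (_+ (f n + g n)) (∑-+ n f g) ⟩
  ∑ n f + ∑ n g + (f n + g n)          ≡⟨ interchange (∑ n f) (∑ n g) (f n) (g n) ⟩
  ∑ n f + f n + (∑ n g + g n)          ∎
  where
  open ≡-Reasoning
  interchange : ∀ a b c d → a + b + (c + d) ≡ a + c + (b + d)
  interchange a b c d = solve (a ∷ b ∷ c ∷ d ∷ [])

∑-*ˡ : ∀ n c f → ∑ n (λ i → c * f i) ≡ c * ∑ n f
∑-*ˡ zero    c f = sym (*-zeroʳ c)
∑-*ˡ (suc n) c f = trans (cong (_+ c * f n) (∑-*ˡ n c f)) (sym (*-distribˡ-+ c (∑ n f) (f n)))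

∑-*ʳ : ∀ n c f → ∑ n (λ i → f i * c) ≡ ∑ n f * c
∑-*ʳ zero    c f = refl
∑-*ʳ (suc n) c f = trans (cong (_+ f n * c) (∑-*ʳ n c f)) (sym (*-distribʳ-+ c (∑ n f) (f n)))

∑-const : ∀ n c → ∑ n (λ _ → c) ≡ n * c
∑-const zero    c = refl
∑-const (suc n) c = trans (cong (_+ c) (∑-const n c)) (+-comm (n * c) c)

∑-swap : ∀ m n (f : ℕ → ℕ → ℕ) → ∑ m (λ i → ∑ n (f i)) ≡ ∑ n (λ j → ∑ m (λ i → f i j))
∑-swap zero    n f = sym (trans (∑-const n 0) (*-zeroʳ n))
∑-swap (suc m) n f = trans (cong (_+ ∑ n (f m)) (∑-swap m n f))
                           (sym (∑-+ n (λ j → ∑ m (λ i → f i j)) (f m)))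

∑-split : ∀ m n f → ∑ (m + n) f ≡ ∑ m f + ∑ n (λ i → f (m + i))
∑-split m zero    f = trans (cong (λ k → ∑ k f) (+-identityʳ m)) (sym (+-identityʳ _))
∑-split m (suc n) f = begin
  ∑ (m + suc n) f                              ≡⟨ cong (λ k → ∑ k f) (+-suc m n) ⟩
  ∑ (m + n) f + f (m + n)                      ≡⟨ cong (_+ f (m + n)) (∑-split m n f) ⟩
  ∑ m f + ∑ n (λ i → f (m + i)) + f (m + n)    ≡⟨ +-assoc (∑ m f) _ _ ⟩
  ∑ m f + (∑ n (λ i → f (m + i)) + f (m + n))  ∎
  where open ≡-Reasoning

∑-monoˡ : ∀ {m n} f → m ≤ n → ∑ m f ≤ ∑ n f
∑-monoˡ {m} {n} f m≤n = begin
  ∑ m f              ≤⟨ m≤m+n _ _ ⟩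
  ∑ m f + ∑ (n ∸ m) (λ i → f (m + i)) ≡⟨ ∑-split m (n ∸ m) f ⟨
  ∑ (m + (n ∸ m)) f  ≡⟨ cong (λ k → ∑ k f) (m+[n∸m]≡n m≤n) ⟩
  ∑ n f              ∎
  where open ≤-Reasoning

term≤∑ : ∀ {n} f {i} → i < n → f i ≤ ∑ n f
term≤∑ f {i} i<n = ≤-trans (m≤n+m (f i) (∑ i f)) (∑-monoˡ f i<n)

𝟙-yes : {P : Set} (P? : Dec P) → P → 𝟙 P? ≡ 1
𝟙-yes (yes _) p = refl
𝟙-yes (no ¬p) p = ⊥-elim (¬p p)

𝟙-mono : {P Q : Set} (P? : Dec P) (Q? : Dec Q) → (P → Q) → 𝟙 P? ≤ 𝟙 Q?
𝟙-mono (yes p) Q? f = ≤-reflexive (sym (𝟙-yes Q? (f p)))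
𝟙-mono (no _)  Q? f = z≤n

-- A set of integers whose distinct elements are at least e apart has at most
-- T / e + 1 elements below T.
spaced : {P : Pred ℕ 0ℓ} (P? : Decidable P) (e : ℕ) →
  (∀ {s t} → s < t → P s → P t → e + s ≤ t) →
  ∀ T → e * ∑ T (λ t → 𝟙 (P? t)) ≤ T + e
spaced {P} P? e gap T with spaced-last T
  where
  -- Either nothing has been counted yet or there is a last counted element.
  spaced-last : ∀ T → ∑ T (λ t → 𝟙 (P? t)) ≡ 0
    ⊎ ∃[ s ] (s < T × P s × e * ∑ T (λ t → 𝟙 (P? t)) ≤ s + e)
  spaced-last zero = inj₁ refl
  spaced-last (suc T) with P? T | spaced-last T
  ... | no _   | inj₁ eq = inj₁ (trans (+-identityʳ _) eq)
  ... | no _   | inj₂ (s , s<T , ps , le) =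
    inj₂ (s , m<n⇒m<1+n s<T , ps , ≤-trans (≤-reflexive (cong (e *_) (+-identityʳ _))) le)
  ... | yes pT | inj₁ eq =
    inj₂ (T , ≤-refl , pT , ≤-trans (≤-reflexive (trans (cong (λ k → e * (k + 1)) eq) (*-identityʳ e)))
                                    (m≤n+m e T))
  ... | yes pT | inj₂ (s , s<T , ps , le) = inj₂ (T , ≤-refl , pT , (begin
    e * (∑ T _ + 1)      ≡⟨ *-distribˡ-+ e _ 1 ⟩
    e * ∑ T _ + e * 1    ≡⟨ cong (e * ∑ T _ +_) (*-identityʳ e) ⟩
    e * ∑ T _ + e        ≤⟨ +-monoˡ-≤ e le ⟩
    s + e + e            ≡⟨ cong (_+ e) (+-comm s e) ⟩
    e + s + e            ≤⟨ +-monoˡ-≤ e (gap s<T ps pT) ⟩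
    T + e                ∎))
    where open ≤-Reasoning
... | inj₁ eq = ≤-trans (≤-reflexive (trans (cong (e *_) eq) (*-zeroʳ e))) z≤n
... | inj₂ (s , s<T , _ , le) = ≤-trans le (+-monoˡ-≤ e (<⇒≤ s<T))

-- A set with no two elements satisfies every gap condition vacuously, in
-- particular the one for gaps longer than T.
atMostOne : {P : Pred ℕ 0ℓ} (P? : Decidable P) → (∀ {s t} → s < t → P s → ¬ P t) →
  ∀ T → ∑ T (λ t → 𝟙 (P? t)) ≤ 1
atMostOne P? unique T = s≤s⁻¹ (*-cancelˡ-< (suc T) _ _ (begin-strict
  suc T * ∑ T _  ≤⟨ spaced P? (suc T) (λ s<t ps pt → ⊥-elim (unique s<t ps pt)) T ⟩
  T + suc T      <⟨ n<1+n _ ⟩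
  suc T + suc T  ≡⟨ two (suc T) ⟩
  suc T * 2      ∎))
  where
  open ≤-Reasoning
  two : ∀ a → a + a ≡ a * 2
  two a = solve (a ∷ [])

module _ {S : Pred ℕ 0ℓ} (S? : Decidable S) where

  length-filter-[_] : ∀ x → length (filter S? (x ∷ [])) ≡ 𝟙 (S? x)
  length-filter-[ x ] with S? x
  ... | yes _ = refl
  ... | no  _ = refl

  count-∑ : ∀ x → count S? x ≡ ∑ x (λ m → 𝟙 (S? (suc m)))
  count-∑ zero    = refl
  count-∑ (suc x) = begin
    length (filter S? (map suc (upTo (suc x))))
      ≡⟨ cong (λ l → length (filter S? (map suc l))) (upTo-∷ʳ x) ⟨
    length (filter S? (map suc (upTo x ++ x ∷ [])))
      ≡⟨ cong (length ∘ filter S?) (map-++ suc (upTo x) (x ∷ [])) ⟩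
    length (filter S? (map suc (upTo x) ++ suc x ∷ []))
      ≡⟨ cong length (filter-++ S? (map suc (upTo x)) (suc x ∷ [])) ⟩
    length (filter S? (map suc (upTo x)) ++ filter S? (suc x ∷ []))
      ≡⟨ length-++ (filter S? (map suc (upTo x))) ⟩
    count S? x + length (filter S? (suc x ∷ []))
      ≡⟨ cong₂ _+_ (count-∑ x) length-filter-[ suc x ] ⟩
    ∑ x (λ m → 𝟙 (S? (suc m))) + 𝟙 (S? (suc x)) ∎
    where open ≡-Reasoning

  count-mono : ∀ {x y} → x ≤ y → count S? x ≤ count S? y
  count-mono {x} {y} x≤y rewrite count-∑ x | count-∑ y = ∑-monoˡ _ x≤y

  -- Distinct elements v 0 < v 1 < ⋯, separated by the values of u, are
  -- counted separately.
  ∑≤count : (u v : ℕ → ℕ) → (∀ t → u t < v t) → (∀ t → v t ≤ u (suc t)) →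
    ∀ T → ∑ T (λ t → 𝟙 (S? (v t))) ≤ count S? (u T)
  ∑≤count u v u<v v≤u zero    = z≤n
  ∑≤count u v u<v v≤u (suc T) with v T in eq | u<v T | v≤u T
  ... | suc w | s≤s uT≤w | w<u = begin
    ∑ T _ + 𝟙 (S? (suc w))                        ≤⟨ +-monoˡ-≤ _ (∑≤count u v u<v v≤u T) ⟩
    count S? (u T) + 𝟙 (S? (suc w))               ≤⟨ +-monoˡ-≤ _ (count-mono uT≤w) ⟩
    count S? w + 𝟙 (S? (suc w))                   ≡⟨ cong (_+ 𝟙 (S? (suc w))) (count-∑ w) ⟩
    ∑ (suc w) (λ m → 𝟙 (S? (suc m)))              ≡⟨ count-∑ (suc w) ⟨
    count S? (suc w)                              ≤⟨ count-mono w<u ⟩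
    count S? (u (suc T))                          ∎
    where open ≤-Reasoning

-- Products and coprimality

-- The product of f i over i < n.
∏ : ℕ → (ℕ → ℕ) → ℕ
∏ zero    f = 1
∏ (suc n) f = ∏ n f * f n

factor∣∏ : ∀ {n} f {i} → i < n → f i ∣ ∏ n f
factor∣∏ {suc n} f {i} i<1+n with i ≟ n
... | yes refl = n∣m*n (∏ n f)
... | no  i≢n  = ∣m⇒∣m*n (f n) (factor∣∏ f (≤∧≢⇒< (s≤s⁻¹ i<1+n) i≢n))

0<∏ : ∀ n {f} → (∀ i → 0 < f i) → 0 < ∏ n f
0<∏ zero    h = s≤s z≤n
0<∏ (suc n) h = *-mono-≤ (0<∏ n h) (h n)

coprime-∣ˡ : ∀ {a b c} → a ∣ b → Coprime b c → Coprime a c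
coprime-∣ˡ a∣b cop (d∣a , d∣c) = cop (∣-trans d∣a a∣b , d∣c)

coprime-∣ʳ : ∀ {a b c} → b ∣ c → Coprime a c → Coprime a b
coprime-∣ʳ b∣c cop (d∣a , d∣b) = cop (d∣a , ∣-trans d∣b b∣c)

coprime-* : ∀ {a b c} → Coprime a b → Coprime a c → Coprime a (b * c)
coprime-* a⊥b a⊥c (d∣a , d∣bc) = a⊥c (d∣a , coprime-divisor (coprime-∣ˡ d∣a a⊥b) d∣bc)

coprime-∏ : ∀ {a} n {f} → (∀ i → i < n → Coprime a (f i)) → Coprime a (∏ n f)
coprime-∏ zero    h = Coprime.sym (1-coprimeTo _)
coprime-∏ (suc n) h = coprime-* (coprime-∏ n λ i i<n → h i (m<n⇒m<1+n i<n)) (h n ≤-refl)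

coprime⇒*∣ : ∀ {a b m} → Coprime a b → a ∣ m → b ∣ m → a * b ∣ m
coprime⇒*∣ {a} {b} a⊥b (divides-refl u) b∣m
  with coprime-divisor (Coprime.sym a⊥b) (subst (b ∣_) (*-comm u a) b∣m)
... | divides-refl v = divides v (trans (*-assoc v b a) (cong (v *_) (*-comm b a)))

primeDivisor : ∀ n → 0 < n → n ≢ 1 → ∃[ p ] (Prime p × p ∣ n)
primeDivisor n@(suc _) _ n≢1 with factorise n
... | record { factors = [] ; isFactorisation = eq } = ⊥-elim (n≢1 eq)
... | record { factors = p ∷ ps ; isFactorisation = eq ; factorsPrime = pr All.∷ _ } =
  p , pr , subst (p ∣_) (sym eq) (m∣m*n _)

commonPrime : ∀ {a b} → 0 < a → ¬ Coprime a b → ∃[ p ] (Prime p × p ∣ a × p ∣ b)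
commonPrime {a} {b} 0<a ¬cop
  with primeDivisor (gcd a b) (n≢0⇒n>0 (gcd[m,n]≢0 a b (inj₁ λ a≡0 → <⇒≢ 0<a (sym a≡0))))
         (λ eq → ¬cop (gcd≡1⇒coprime eq))
... | p , pr , p∣g = p , pr , ∣-trans p∣g (gcd[m,n]∣m a b) , ∣-trans p∣g (gcd[m,n]∣n a b)

prime∤⇒coprime : ∀ {p n} → Prime p → p ∤ n → Coprime p n
prime∤⇒coprime pr p∤n (d∣p , d∣n) with prime⇒irreducible pr d∣p
... | inj₁ d≡1  = d≡1
... | inj₂ refl = ⊥-elim (p∤n d∣n)

-- Two terms divisible by e of a progression whose difference c is coprime to e
-- are at least e steps apart.
progression-gap : ∀ {e c} v → Coprime e c → ∀ {s t} → s < t →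
  e ∣ v + c * s → e ∣ v + c * t → e + s ≤ t
progression-gap {e} {c} v cop {s} {t} s<t e∣s e∣t =
  subst (_≤ t) (+-comm s e) (≤-trans (+-monoʳ-≤ s e≤u) (≤-reflexive t≡))
  where
  u : ℕ
  u = t ∸ s
  t≡ : s + u ≡ t
  t≡ = m+[n∸m]≡n (<⇒≤ s<t)
  split : v + c * t ≡ v + c * s + c * u
  split = trans (cong (λ x → v + c * x) (sym t≡))
    (trans (cong (v +_) (*-distribˡ-+ c s u)) (sym (+-assoc v (c * s) (c * u))))
  instance
    u≢0 : NonZero u
    u≢0 = >-nonZero (m<n⇒0<n∸m s<t)
  e≤u : e ≤ u
  e≤u = ∣⇒≤ (coprime-divisor cop (∣m+n∣m⇒∣n (subst (e ∣_) split e∣t) e∣s))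

prime∣∏ : ∀ n {f p} → Prime p → p ∣ ∏ n f → ∃[ i ] (i < n × p ∣ f i)
prime∣∏ zero    pr p∣1 = ⊥-elim (¬prime[1] (subst Prime (∣1⇒≡1 p∣1) pr))
prime∣∏ (suc n) {f} pr p∣Π with euclidsLemma (∏ n f) (f n) pr p∣Π
... | inj₂ p∣fn = n , ≤-refl , p∣fn
... | inj₁ p∣Πn with prime∣∏ n pr p∣Πn
...   | i , i<n , p∣fi = i , m<n⇒m<1+n i<n , p∣fi

linearCongruence : ∀ {M q} → Coprime M q → 0 < q → ∀ c → ∃[ t ] (q ∣ c + M * t)
linearCongruence {M} {suc q} cop _ c with coprime-Bézout cop
... | Bézout.+- x y 1+yq≡xM = x * (c * q) , divides (c + y * (c * q)) (begin
  c + M * (x * (c * q))           ≡⟨ cong (c +_) (assoc M x (c * q)) ⟩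
  c + x * M * (c * q)             ≡⟨ cong (λ w → c + w * (c * q)) 1+yq≡xM ⟨
  c + (1 + y * suc q) * (c * q)   ≡⟨ collect c y q ⟩
  (c + y * (c * q)) * suc q       ∎)
  where
  open ≡-Reasoning
  assoc : ∀ M x w → M * (x * w) ≡ x * M * w
  assoc M x w = solve (M ∷ x ∷ w ∷ [])
  collect : ∀ c y q → c + (1 + y * (1 + q)) * (c * q) ≡ (c + y * (c * q)) * (1 + q)
  collect c y q = solve (c ∷ y ∷ q ∷ [])
... | Bézout.-+ x y 1+xM≡yq = x * c , divides (y * c) (begin
  c + M * (x * c)                 ≡⟨ collect c M x ⟩
  (1 + x * M) * c                 ≡⟨ cong (_* c) 1+xM≡yq ⟩
  y * suc q * c                   ≡⟨ swap y (suc q) c ⟩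
  y * c * suc q                   ∎)
  where
  open ≡-Reasoning
  collect : ∀ c M x → c + M * (x * c) ≡ (1 + x * M) * c
  collect c M x = solve (c ∷ M ∷ x ∷ [])
  swap : ∀ a b c → a * b * c ≡ a * c * b
  swap a b c = solve (a ∷ b ∷ c ∷ [])

chineseRemainder : ∀ N k (q r : ℕ → ℕ) → (∀ i → 0 < q i) → (∀ i → Coprime N (q i)) →
  (∀ {i j} → i < j → j < k → Coprime (q i) (q j)) →
  ∃[ n ] (N ∣ n × (∀ i → i < k → q i ∣ n + r i))
chineseRemainder N zero    q r 0<q N⊥q pairwise = 0 , (N ∣0) , λ _ ()
chineseRemainder N (suc k) q r 0<q N⊥q pairwise
  with chineseRemainder N k q r 0<q N⊥q (λ i<j j<k → pairwise i<j (m<n⇒m<1+n j<k))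
... | n , N∣n , q∣n+r
  with linearCongruence (Coprime.sym (coprime-* (Coprime.sym (N⊥q k)) (coprime-∏ k λ i i<k → Coprime.sym (pairwise i<k ≤-refl))))
         (0<q k) (n + r k)
... | t , qk∣ = n + M * t , ∣m∣n⇒∣m+n N∣n (∣m⇒∣m*n t (m∣m*n (∏ k q))) , divs
  where
  M : ℕ
  M = N * ∏ k q
  shuffle : ∀ i → n + r i + M * t ≡ n + M * t + r i
  shuffle i = trans (+-assoc n (r i) (M * t)) (trans (cong (n +_) (+-comm (r i) (M * t))) (sym (+-assoc n (M * t) (r i))))
  divs : ∀ i → i < suc k → q i ∣ n + M * t + r i
  divs i i<1+k with i ≟ k
  ... | yes refl = subst (q k ∣_) (shuffle k) qk∣
  ... | no  i≢k  = subst (q i ∣_) (shuffle i) (∣m∣n⇒∣m+n (q∣n+r i i<k) (∣m⇒∣m*n t (∣n⇒∣m*n N (factor∣∏ q i<k))))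
    where
    i<k : i < k
    i<k = ≤∧≢⇒< (s≤s⁻¹ i<1+k) i≢k

-- Upper bounds for the totient function

-- Coprimality with Q is periodic with period Q.
∑-coprime : ∀ w Q → ∑ (w * Q) (λ b → 𝟙 (coprime? (suc b) Q)) ≡ w * φ Q
∑-coprime zero    Q = refl
∑-coprime (suc w) Q = begin
  ∑ (Q + w * Q) f
    ≡⟨ ∑-split Q (w * Q) f ⟩
  ∑ Q f + ∑ (w * Q) (λ b → f (Q + b))
    ≡⟨ cong₂ _+_ (sym (count-∑ _ Q)) (∑-cong (w * Q) shift) ⟩
  φ Q + ∑ (w * Q) f
    ≡⟨ cong (φ Q +_) (∑-coprime w Q) ⟩
  φ Q + w * φ Q ∎
  where
  open ≡-Reasoning
  f : ℕ → ℕ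
  f b = 𝟙 (coprime? (suc b) Q)
  eq : ∀ b → suc (Q + b) ≡ Q + suc b
  eq b = sym (+-suc Q b)
  shift : ∀ b → f (Q + b) ≡ f b
  shift b = ≤-antisym
    (𝟙-mono (coprime? _ Q) (coprime? _ Q) λ c {d} (d∣b , d∣Q) →
      c (subst (d ∣_) (sym (eq b)) (∣m∣n⇒∣m+n d∣Q d∣b) , d∣Q))
    (𝟙-mono (coprime? _ Q) (coprime? _ Q) λ c {d} (d∣b , d∣Q) →
      c (∣m+n∣m⇒∣n (subst (d ∣_) (eq b) d∣b) d∣Q , d∣Q))

-- In terms of ratios, φ(m)/m ≤ φ(d)/d for every divisor d of m.
φ-∣ : ∀ {d m} → d ∣ m → φ m * d ≤ φ d * m
φ-∣ {d} (divides-refl w) = begin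
  φ (w * d) * d
    ≡⟨ cong (_* d) (count-∑ _ (w * d)) ⟩
  ∑ (w * d) (λ b → 𝟙 (coprime? (suc b) (w * d))) * d
    ≤⟨ *-monoˡ-≤ d (∑-mono (w * d) λ b _ →
         𝟙-mono (coprime? _ _) (coprime? _ _) (coprime-∣ʳ (n∣m*n w))) ⟩
  ∑ (w * d) (λ b → 𝟙 (coprime? (suc b) d)) * d
    ≡⟨ cong (_* d) (∑-coprime w d) ⟩
  w * φ d * d
    ≡⟨ assoc w (φ d) ⟩
  φ d * (w * d) ∎
  where
  open ≤-Reasoning
  assoc : ∀ w p → w * p * d ≡ p * (w * d)
  assoc w p = solve (w ∷ p ∷ d ∷ [])

-- For distinct divisors n 0, n 1, … of Q the sets
-- { n j * b | b coprime to Q } are disjoint, because n i * b ≡ n j * b′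
-- forces n i and n j to divide each other.  As the j-th set has density
-- φ(Q)/Q / n j, the sum of these densities is at most 1.
module _ (Q J : ℕ) (n : ℕ → ℕ) .{{n≢0 : ∀ {j} → NonZero (n j)}}
  (n∣Q : ∀ {j} → j < J → n j ∣ Q) (n-injective : ∀ {i j} → n i ≡ n j → i ≡ j) where

  private
    -- a lies in the j-th of these sets.  The condition n j ∣ Q is included to
    -- make the sets disjoint for all j, not only for j < J.
    InSet : ℕ → ℕ → Set
    InSet a j = n j ∣ Q × n j ∣ a × Coprime (a / n j) Q

    inSet? : ∀ a → Decidable (InSet a)
    inSet? a j = (n j ∣? Q) ×-dec (n j ∣? a) ×-dec coprime? (a / n j) Q

    mutual-∣ : ∀ {a i j} → InSet a i → InSet a j → n i ∣ n j
    mutual-∣ {a} {i} {j} (ni∣Q , ni∣a , _) (_ , nj∣a , cop) =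
      coprime-divisor (coprime-∣ˡ ni∣Q (Coprime.sym cop))
        (subst (n i ∣_) (trans (sym (m*[n/m]≡n nj∣a)) (*-comm (n j) (a / n j))) ni∣a)

    disjoint : ∀ {a i j} → i < j → InSet a i → ¬ InSet a j
    disjoint i<j p q = <⇒≢ i<j (n-injective (∣-antisym (mutual-∣ p q) (mutual-∣ q p)))

    size : ∀ j → j < J → Q / n j * φ Q ≤ count (λ a → inSet? a j) (Q * Q)
    size j j<J = begin
      Q / n j * φ Q
        ≡⟨ ∑-coprime (Q / n j) Q ⟨
      ∑ (Q / n j * Q) (λ b → 𝟙 (coprime? (suc b) Q))
        ≤⟨ ∑-mono (Q / n j * Q) (λ b _ → 𝟙-mono (coprime? _ _) (inSet? _ j) λ cop →
             n∣Q j<J , m∣m*n (suc b) ,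
             subst (λ c → Coprime c Q) (sym (trans (cong (_/ n j) (*-comm (n j) (suc b))) (m*n/n≡m (suc b) (n j)))) cop) ⟩
      ∑ (Q / n j * Q) (λ b → 𝟙 (inSet? (n j * suc b) j))
        ≤⟨ ∑≤count (λ a → inSet? a j) (n j *_) (λ t → n j * suc t)
             (λ t → *-monoʳ-< (n j) (n<1+n t)) (λ t → ≤-refl) (Q / n j * Q) ⟩
      count (λ a → inSet? a j) (n j * (Q / n j * Q))
        ≡⟨ cong (count (λ a → inSet? a j)) (trans (sym (*-assoc (n j) _ Q))
             (cong (_* Q) (m*[n/m]≡n (n∣Q j<J)))) ⟩
      count (λ a → inSet? a j) (Q * Q) ∎
      where open ≤-Reasoning

  ∑-disjoint-multiples : ∑ J (λ j → Q / n j) * φ Q ≤ Q * Q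
  ∑-disjoint-multiples = begin
    ∑ J (λ j → Q / n j) * φ Q
      ≡⟨ ∑-*ʳ J (φ Q) (λ j → Q / n j) ⟨
    ∑ J (λ j → Q / n j * φ Q)
      ≤⟨ ∑-mono J size ⟩
    ∑ J (λ j → count (λ a → inSet? a j) (Q * Q))
      ≡⟨ ∑-cong J (λ j → count-∑ _ (Q * Q)) ⟩
    ∑ J (λ j → ∑ (Q * Q) (λ a → 𝟙 (inSet? (suc a) j)))
      ≡⟨ ∑-swap J (Q * Q) _ ⟩
    ∑ (Q * Q) (λ a → ∑ J (λ j → 𝟙 (inSet? (suc a) j)))
      ≤⟨ ∑-mono (Q * Q) (λ a _ → atMostOne (inSet? (suc a)) disjoint J) ⟩
    ∑ (Q * Q) (λ _ → 1)
      ≡⟨ ∑-const (Q * Q) 1 ⟩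
    Q * Q * 1
      ≡⟨ *-identityʳ (Q * Q) ⟩
    Q * Q ∎
    where open ≤-Reasoning

-- The harmonic series over the progression 1, 1 + N, 1 + 2N, … diverges:
-- each dyadic block of j contributes at least 1/(2N).  Here all the
-- fractions Q / (1 + N j) are exact.
∑-progression : ∀ Q N A → 0 < N → (∀ {j} → j < 2 ^ A → suc (N * j) ∣ Q) →
  A * Q ≤ 2 * N * ∑ (2 ^ A) (λ j → Q / suc (N * j))
∑-progression Q N zero    0<N div = z≤n
∑-progression Q N (suc A) 0<N div = begin
  Q + A * Q
    ≤⟨ +-mono-≤ block (∑-progression Q N A 0<N λ j< → div (<-≤-trans j< (^-monoʳ-≤ 2 (n≤1+n A)))) ⟩
  2 * N * ∑ B (λ i → w (B + i)) + 2 * N * ∑ B w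
    ≡⟨ *-distribˡ-+ (2 * N) _ _ ⟨
  2 * N * (∑ B (λ i → w (B + i)) + ∑ B w)
    ≡⟨ cong (2 * N *_) (trans (+-comm _ (∑ B w)) (sym (∑-split B B w))) ⟩
  2 * N * ∑ (B + B) w
    ≡⟨ cong (λ k → 2 * N * ∑ k w) double ⟨
  2 * N * ∑ (2 ^ suc A) w ∎
  where
  open ≤-Reasoning
  B : ℕ
  B = 2 ^ A
  instance B≢0 : NonZero B
           B≢0 = m^n≢0 2 A
  w : ℕ → ℕ
  w j = Q / suc (N * j)
  double : 2 ^ suc A ≡ B + B
  double = cong (B +_) (+-identityʳ B)
  small : ∀ i → i < B → suc (N * (B + i)) ≤ 2 * N * B
  small i i<B = begin
    suc (N * (B + i))   ≤⟨ +-monoˡ-≤ _ 0<N ⟩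
    N + N * (B + i)     ≡⟨ *-suc N (B + i) ⟨
    N * suc (B + i)     ≡⟨ cong (N *_) (+-suc B i) ⟨
    N * (B + suc i)     ≤⟨ *-monoʳ-≤ N (+-monoʳ-≤ B i<B) ⟩
    N * (B + B)         ≡⟨ rearrange N B ⟩
    2 * N * B           ∎
    where
    rearrange : ∀ N B → N * (B + B) ≡ 2 * N * B
    rearrange N B = solve (N ∷ B ∷ [])
  term : ∀ i → i < B → Q ≤ 2 * N * B * w (B + i)
  term i i<B = begin
    Q                             ≡⟨ m*[n/m]≡n (div (subst (B + i <_) (sym double) (+-monoʳ-< B i<B))) ⟨
    suc (N * (B + i)) * w (B + i) ≤⟨ *-monoˡ-≤ (w (B + i)) (small i i<B) ⟩
    2 * N * B * w (B + i)         ∎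
  block : Q ≤ 2 * N * ∑ B (λ i → w (B + i))
  block = *-cancelˡ-≤ B (begin
    B * Q                                  ≡⟨ ∑-const B Q ⟨
    ∑ B (λ _ → Q)                          ≤⟨ ∑-mono B term ⟩
    ∑ B (λ i → 2 * N * B * w (B + i))      ≡⟨ ∑-*ˡ B (2 * N * B) _ ⟩
    2 * N * B * ∑ B (λ i → w (B + i))      ≡⟨ rearrange (2 * N) B _ ⟩
    B * (2 * N * ∑ B (λ i → w (B + i)))    ∎)
    where
    rearrange : ∀ a b c → a * b * c ≡ b * (a * c)
    rearrange a b c = solve (a ∷ b ∷ c ∷ [])

-- φ(Q)/Q can be made arbitrarily small with Q coprime to a given N: take the
-- product of sufficiently many terms 1 + N j, all of which are divisors of Q
-- coprime to N.  As the sum of 1 / (1 + N j) over j < 2 ^ A is at least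
-- A / (2N), the choice A = 2 N q makes it at least q.
smallTotientRatio : ∀ N q → 0 < N → ∃[ Q ] (0 < Q × Coprime N Q × q * φ Q ≤ Q)
smallTotientRatio N q 0<N = Q , 0<Q , N⊥Q , *-cancelʳ-≤ _ _ Q (begin
  q * φ Q * Q          ≡⟨ rearrange q (φ Q) Q ⟩
  q * Q * φ Q          ≤⟨ *-monoˡ-≤ (φ Q) qQ≤ ⟩
  ∑ J (λ j → Q / n j) * φ Q ≤⟨ ∑-disjoint-multiples Q J n n∣Q n-injective ⟩
  Q * Q                ∎)
  where
  open ≤-Reasoning
  J : ℕ
  J = 2 ^ (2 * N * q)
  n : ℕ → ℕ
  n j = suc (N * j)
  Q : ℕ
  Q = ∏ J n
  instance
    N≢0 : NonZero N
    N≢0 = >-nonZero 0<N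
  0<Q : 0 < Q
  0<Q = 0<∏ J λ j → s≤s z≤n
  instance
    Q≢0 : NonZero Q
    Q≢0 = >-nonZero 0<Q
  n∣Q : ∀ {j} → j < J → n j ∣ Q
  n∣Q = factor∣∏ n
  n-injective : ∀ {i j} → n i ≡ n j → i ≡ j
  n-injective eq = *-cancelˡ-≡ _ _ N (suc-injective eq)
  N⊥Q : Coprime N Q
  N⊥Q = coprime-∏ J λ j _ {d} (d∣N , d∣n) →
    ∣1⇒≡1 (∣m+n∣m⇒∣n (subst (d ∣_) (+-comm 1 (N * j)) d∣n) (∣m⇒∣m*n j d∣N))
  qQ≤ : q * Q ≤ ∑ J (λ j → Q / n j)
  qQ≤ = *-cancelˡ-≤ (2 * N) {{m*n≢0 2 N}} (≤-trans (≤-reflexive (sym (*-assoc (2 * N) q Q)))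
    (∑-progression Q N (2 * N * q) 0<N n∣Q))
  rearrange : ∀ a b c → a * b * c ≡ a * c * b
  rearrange a b c = solve (a ∷ b ∷ c ∷ [])

-- Lower bounds for the totient function on average

-- The sum of 1/e² over e > z is at most 1/z, cleared of denominators: the terms
-- f e are only assumed to be at most C/e².
inverseSquares-tail : ∀ {C} n z (f : ℕ → ℕ) →
  (∀ i → i < n → suc (z + i) * suc (z + i) * f (suc (z + i)) ≤ C) →
  z * ∑ n (λ i → f (suc (z + i))) ≤ C
inverseSquares-tail zero    z f h = ≤-trans (≤-reflexive (*-zeroʳ z)) z≤n
inverseSquares-tail {C} (suc n) z f h = *-cancelˡ-≤ (suc z) (begin
  suc z * (z * ∑ (suc n) F)
    ≡⟨ cong (λ x → suc z * (z * x)) (∑-split 1 n F) ⟩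
  suc z * (z * (f (suc (z + 0)) + ∑ n (λ i → F (suc i))))
    ≡⟨ cong₂ (λ x y → suc z * (z * (f (suc x) + y))) (+-identityʳ z)
         (∑-cong n λ i → cong (λ x → f (suc x)) (+-suc z i)) ⟩
  suc z * (z * (f (suc z) + ∑ n (λ i → f (suc (suc z + i)))))
    ≡⟨ distribute z (f (suc z)) _ ⟩
  suc z * z * f (suc z) + z * (suc z * ∑ n (λ i → f (suc (suc z + i))))
    ≤⟨ +-mono-≤ (*-monoˡ-≤ (f (suc z)) (*-monoʳ-≤ (suc z) (n≤1+n z)))
         (*-monoʳ-≤ z (inverseSquares-tail n (suc z) f λ i i<n →
           subst (λ x → suc x * suc x * f (suc x) ≤ C) (+-suc z i) (h (suc i) (s≤s i<n)))) ⟩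
  suc z * suc z * f (suc z) + z * C
    ≤⟨ +-monoˡ-≤ (z * C) (subst (λ x → suc x * suc x * f (suc x) ≤ C) (+-identityʳ z) (h 0 (s≤s z≤n))) ⟩
  suc z * C ∎)
  where
  open ≤-Reasoning
  F : ℕ → ℕ
  F i = f (suc (z + i))
  distribute : ∀ z a s → suc z * (z * (a + s)) ≡ suc z * z * a + z * (suc z * s)
  distribute z a s = solve (z ∷ a ∷ s ∷ [])

inverseSquares : ∀ {C} n z (f : ℕ → ℕ) → (∀ e → e ≤ z → f e ≡ 0) → (∀ e → e < n → e * e * f e ≤ C) →
  z * ∑ n f ≤ C
inverseSquares {C} n z f small large with ≤-total n (suc z)
... | inj₁ n≤1+z = ≤-trans (≤-reflexive (begin
  z * ∑ n f          ≡⟨ cong (z *_) (n≤0⇒n≡0 (≤-trans (∑-mono n λ e e<n →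
                          ≤-reflexive (small e (s≤s⁻¹ (<-≤-trans e<n n≤1+z))))
                          (≤-reflexive (trans (∑-const n 0) (*-zeroʳ n))))) ⟩
  z * 0              ≡⟨ *-zeroʳ z ⟩
  0                  ∎)) z≤n
  where open ≡-Reasoning
... | inj₂ 1+z≤n = begin
  z * ∑ n f
    ≡⟨ cong (λ k → z * ∑ k f) n≡ ⟨
  z * ∑ (suc z + k) f
    ≡⟨ cong (z *_) (∑-split (suc z) k f) ⟩
  z * (∑ (suc z) f + ∑ k (λ i → f (suc (z + i))))
    ≤⟨ *-monoʳ-≤ z (+-monoˡ-≤ _ (∑-mono (suc z) λ e e≤z → ≤-reflexive (small e (s≤s⁻¹ e≤z)))) ⟩
  z * (∑ (suc z) (λ _ → 0) + ∑ k (λ i → f (suc (z + i))))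
    ≡⟨ cong (λ x → z * (x + ∑ k (λ i → f (suc (z + i))))) (trans (∑-const (suc z) 0) (*-zeroʳ (suc z))) ⟩
  z * ∑ k (λ i → f (suc (z + i)))
    ≤⟨ inverseSquares-tail k z f (λ i i<k → large (suc (z + i)) (subst (suc (z + i) <_) n≡ (+-monoʳ-< (suc z) i<k))) ⟩
  C ∎
  where
  open ≤-Reasoning
  k : ℕ
  k = n ∸ suc z
  n≡ : suc z + k ≡ n
  n≡ = m+[n∸m]≡n 1+z≤n

module _ (D : ℕ) where

  -- The primes not dividing the modulus D.
  Foreign : Pred ℕ _
  Foreign e = Prime e × e ∤ D

  foreign? : Decidable Foreign
  foreign? e = prime? e ×-dec ¬? (e ∣? D)

  foreign-coprime : ∀ {e c} → Foreign e → c ∣ D → Coprime e c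
  foreign-coprime (pr , e∤D) c∣D = prime∤⇒coprime pr λ e∣c → e∤D (∣-trans e∣c c∣D)

  -- For a foreign prime e, the number of s < L with e ∣ 1 + d s; zero for any
  -- other e.
  hits : ℕ → ℕ → ℕ → ℕ
  hits d L e = 𝟙 (foreign? e) * ∑ L (λ s → 𝟙 (e ∣? suc (d * s)))

  -- Among the M integers 1 + d s up to m = d M, those not coprime to m share
  -- with m a prime, which cannot divide d and hence is foreign and divides M.
  totient-lower : ∀ d M L → 0 < d → 0 < M → M ≤ L → (∀ {p} → Prime p → p ∣ d * M → p ∣ D → p ∣ d) →
    M ≤ φ (d * M) + ∑ (suc L) (λ e → 𝟙 (e ∣? M) * hits d L e)
  totient-lower d M L 0<d 0<M M≤L native = begin
    M
      ≡⟨ trans (∑-const M 1) (*-identityʳ M) ⟨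
    ∑ M (λ _ → 1)
      ≤⟨ ∑-mono M (λ s _ → pointwise s) ⟩
    ∑ M (λ s → 𝟙 (cop? s) + ∑ (suc L) (λ e → 𝟙 (e ∣? M) * hit e s))
      ≡⟨ ∑-+ M _ _ ⟩
    ∑ M (λ s → 𝟙 (cop? s)) + ∑ M (λ s → ∑ (suc L) (λ e → 𝟙 (e ∣? M) * hit e s))
      ≡⟨ cong (∑ M (λ s → 𝟙 (cop? s)) +_) (∑-swap M (suc L) _) ⟩
    ∑ M (λ s → 𝟙 (cop? s)) + ∑ (suc L) (λ e → ∑ M (λ s → 𝟙 (e ∣? M) * hit e s))
      ≤⟨ +-mono-≤
           (∑≤count (λ a → coprime? a (d * M)) (d *_) (λ s → suc (d * s)) (λ s → ≤-refl)
             (λ s → *-monoʳ-< d {{>-nonZero 0<d}} (n<1+n s)) M)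
           (∑-mono (suc L) λ e _ → extend e) ⟩
    φ (d * M) + ∑ (suc L) (λ e → 𝟙 (e ∣? M) * hits d L e) ∎
    where
    open ≤-Reasoning
    cop? : ∀ s → Dec (Coprime (suc (d * s)) (d * M))
    cop? s = coprime? (suc (d * s)) (d * M)
    hit : ℕ → ℕ → ℕ
    hit e s = 𝟙 (foreign? e) * 𝟙 (e ∣? suc (d * s))
    extend : ∀ e → ∑ M (λ s → 𝟙 (e ∣? M) * hit e s) ≤ 𝟙 (e ∣? M) * hits d L e
    extend e = begin
      ∑ M (λ s → 𝟙 (e ∣? M) * hit e s)
        ≡⟨ ∑-*ˡ M (𝟙 (e ∣? M)) (hit e) ⟩
      𝟙 (e ∣? M) * ∑ M (hit e)
        ≡⟨ cong (𝟙 (e ∣? M) *_) (∑-*ˡ M (𝟙 (foreign? e)) _) ⟩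
      𝟙 (e ∣? M) * hits d M e
        ≤⟨ *-monoʳ-≤ (𝟙 (e ∣? M)) (*-monoʳ-≤ (𝟙 (foreign? e)) (∑-monoˡ _ M≤L)) ⟩
      𝟙 (e ∣? M) * hits d L e ∎
    pointwise : ∀ s → 1 ≤ 𝟙 (cop? s) + ∑ (suc L) (λ e → 𝟙 (e ∣? M) * hit e s)
    pointwise s with cop? s
    ... | yes _   = s≤s z≤n
    ... | no ¬cop with commonPrime (s≤s z≤n) ¬cop
    ...   | p , pr , p∣a , p∣m = ≤-trans (≤-reflexive (sym one)) (term≤∑ _ (s≤s (≤-trans p≤M M≤L)))
      where
      p∤d : p ∤ d
      p∤d p∣d = ¬prime[1] (subst Prime (∣1⇒≡1 (∣m+n∣m⇒∣n
        (subst (p ∣_) (+-comm 1 (d * s)) p∣a) (∣m⇒∣m*n s p∣d))) pr)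
      p∣M : p ∣ M
      p∣M = coprime-divisor (prime∤⇒coprime pr p∤d) p∣m
      p≤M : p ≤ M
      p≤M = ∣⇒≤ {{>-nonZero 0<M}} p∣M
      one : 𝟙 (p ∣? M) * hit p s ≡ 1
      one rewrite 𝟙-yes (p ∣? M) p∣M | 𝟙-yes (foreign? p) (pr , λ p∣D → p∤d (native pr p∣m p∣D))
        | 𝟙-yes (p ∣? suc (d * s)) p∣a = refl

-- The numbers d (v + c t) with t < T form a window of a progression in which the
-- only primes dividing both D and the number are those of d, and every prime up
-- to z divides D.  Because of the bounds on v, the cofactors v + c t are of the
-- same order of magnitude throughout the window.
module Window
  {D d c v T z : ℕ} (d∣D : d ∣ D) (c∣D : c ∣ D) (0<d : 0 < d) (0<c : 0 < c) (0<T : 0 < T)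
  (cT≤v : c * T ≤ v) (v≤2cT : v ≤ 2 * (c * T))
  (smallPrimes : ∀ {p} → Prime p → p ≤ z → p ∣ D)
  (native : ∀ t {p} → Prime p → p ∣ d * (v + c * t) → p ∣ D → p ∣ d)
  where

  private
    M : ℕ → ℕ
    M t = v + c * t

    -- A common upper bound for the M t.
    L : ℕ
    L = v + c * T

    -- h e counts the t < T with e ∣ M t and, for foreign e, g e counts the s < L
    -- with e ∣ 1 + d s.  For e ≤ T their product is of order at most T L / e².
    h g : ℕ → ℕ
    h e = ∑ T (λ t → 𝟙 (e ∣? M t))
    g e = hits D d L e

    T≤cT : T ≤ c * T
    T≤cT = m≤n*m T c {{>-nonZero 0<c}}

    0<v : 0 < v
    0<v = <-≤-trans 0<T (≤-trans T≤cT cT≤v)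

    0<L : 0 < L
    0<L = <-≤-trans 0<v (m≤m+n v _)

    T≤L : T ≤ L
    T≤L = ≤-trans T≤cT (m≤n+m (c * T) v)

    eh≤ : ∀ {e} → Foreign D e → e * h e ≤ T + e
    eh≤ {e} fe = spaced (λ t → e ∣? M t) e (progression-gap v (foreign-coprime D fe c∣D)) T

    eg≤ : ∀ {e} → e ≤ L → e * g e ≤ 2 * L
    eg≤ {e} e≤L with foreign? D e
    ... | no _   = ≤-trans (≤-reflexive (*-zeroʳ e)) z≤n
    ... | yes fe = begin
      e * (1 * ∑ L (λ s → 𝟙 (e ∣? suc (d * s))))
        ≡⟨ cong (e *_) (*-identityˡ _) ⟩
      e * ∑ L (λ s → 𝟙 (e ∣? suc (d * s)))
        ≤⟨ spaced (λ s → e ∣? suc (d * s)) e (progression-gap 1 (foreign-coprime D fe d∣D)) L ⟩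
      L + e
        ≤⟨ +-monoʳ-≤ L e≤L ⟩
      L + L
        ≡⟨ cong (L +_) (+-identityʳ L) ⟨
      2 * L ∎
      where open ≤-Reasoning

    -- hits vanishes unless e is foreign, which reduces estimates for h e * g e
    -- to that case.
    byForeign : ∀ {e C} k → (Foreign D e → k * (h e * g e) ≤ C) → k * (h e * g e) ≤ C
    byForeign {e} k bound with foreign? D e
    ... | yes fe = bound fe
    ... | no _   = ≤-trans (≤-reflexive (trans (cong (k *_) (*-zeroʳ (h e))) (*-zeroʳ k))) z≤n

    smallFactor : ∀ e → e < suc T → e * e * (h e * g e) ≤ 2 * T * (2 * L)
    smallFactor e (s≤s e≤T) = byForeign (e * e) λ fe → begin
      e * e * (h e * g e)      ≡⟨ rearrange e (h e) (g e) ⟩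
      (e * h e) * (e * g e)    ≤⟨ *-mono-≤ (eh≤ fe) (eg≤ (≤-trans e≤T T≤L)) ⟩
      (T + e) * (2 * L)        ≤⟨ *-monoˡ-≤ (2 * L) (+-monoʳ-≤ T e≤T) ⟩
      (T + T) * (2 * L)        ≡⟨ cong (λ x → (T + x) * (2 * L)) (+-identityʳ T) ⟨
      2 * T * (2 * L)          ∎
      where
      open ≤-Reasoning
      rearrange : ∀ a b c → a * a * (b * c) ≡ a * b * (a * c)
      rearrange a b c = solve (a ∷ b ∷ c ∷ [])

    largeFactor : ∀ e → T < e → e ≤ L → T * (h e * g e) ≤ 2 * L
    largeFactor e T<e e≤L = byForeign T λ fe → begin
      T * (h e * g e)   ≤⟨ *-monoʳ-≤ T (*-monoˡ-≤ (g e) (h≤1 fe)) ⟩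
      T * (1 * g e)     ≡⟨ cong (T *_) (*-identityˡ (g e)) ⟩
      T * g e           ≤⟨ *-monoˡ-≤ (g e) (<⇒≤ T<e) ⟩
      e * g e           ≤⟨ eg≤ e≤L ⟩
      2 * L             ∎
      where
      open ≤-Reasoning
      h≤1 : Foreign D e → h e ≤ 1
      h≤1 fe = s≤s⁻¹ (*-cancelˡ-< e (h e) 2 (begin-strict
        e * h e  ≤⟨ eh≤ fe ⟩
        T + e    <⟨ +-monoˡ-< e T<e ⟩
        e + e    ≡⟨ cong (e +_) (+-identityʳ e) ⟨
        2 * e    ≡⟨ *-comm 2 e ⟩
        e * 2    ∎))

    noSmallForeign : ∀ e → e ≤ z → h e * g e ≡ 0
    noSmallForeign e e≤z = n≤0⇒n≡0 (≤-trans (≤-reflexive (sym (*-identityˡ (h e * g e))))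
      (byForeign 1 λ (pr , e∤D) → ⊥-elim (e∤D (smallPrimes pr e≤z))))

    -- The double sum over e ≤ L, split at e = T: below T the sum of 1/e² is
    -- small, above T each of the at most L values of e contributes little.
    pairs : z * ∑ (suc L) (λ e → h e * g e) ≤ L * (4 * T + 6 * (z * c))
    pairs = *-cancelˡ-≤ T {{>-nonZero 0<T}} (begin
      T * (z * ∑ (suc L) F)
        ≡⟨ cong (λ n → T * (z * ∑ (suc n) F)) (m+[n∸m]≡n T≤L) ⟨
      T * (z * ∑ (suc T + K) F)
        ≡⟨ cong (λ x → T * (z * x)) (∑-split (suc T) K F) ⟩
      T * (z * (∑ (suc T) F + ∑ K (λ i → F (suc T + i))))
        ≡⟨ expand T z _ _ ⟩
      T * (z * ∑ (suc T) F) + z * (T * ∑ K (λ i → F (suc T + i)))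
        ≡⟨ cong (λ x → T * (z * ∑ (suc T) F) + z * x) (∑-*ˡ K T _) ⟨
      T * (z * ∑ (suc T) F) + z * ∑ K (λ i → T * F (suc T + i))
        ≤⟨ +-mono-≤ (*-monoʳ-≤ T (inverseSquares (suc T) z F noSmallForeign smallFactor))
             (*-monoʳ-≤ z (∑-mono K λ i i<K → largeFactor (suc T + i) (s≤s (m≤m+n T i))
               (≤-trans (≤-reflexive (sym (+-suc T i)))
                 (≤-trans (+-monoʳ-≤ T i<K) (≤-reflexive (m+[n∸m]≡n T≤L)))))) ⟩
      T * (2 * T * (2 * L)) + z * ∑ K (λ _ → 2 * L)
        ≡⟨ cong (λ x → T * (2 * T * (2 * L)) + z * x) (∑-const K (2 * L)) ⟩
      T * (2 * T * (2 * L)) + z * (K * (2 * L))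
        ≤⟨ +-monoʳ-≤ _ (*-monoʳ-≤ z (*-monoˡ-≤ (2 * L) (≤-trans (m∸n≤m L T) L≤3cT))) ⟩
      T * (2 * T * (2 * L)) + z * (3 * (c * T) * (2 * L))
        ≡⟨ collect T z c L ⟩
      T * (L * (4 * T + 6 * (z * c))) ∎)
      where
      open ≤-Reasoning
      F : ℕ → ℕ
      F e = h e * g e
      K : ℕ
      K = L ∸ T
      L≤3cT : L ≤ 3 * (c * T)
      L≤3cT = begin
        v + c * T                ≤⟨ +-monoˡ-≤ (c * T) v≤2cT ⟩
        2 * (c * T) + c * T      ≡⟨ +-comm (2 * (c * T)) (c * T) ⟩
        3 * (c * T)              ∎
      expand : ∀ T z a b → T * (z * (a + b)) ≡ T * (z * a) + z * (T * b)
      expand T z a b = solve (T ∷ z ∷ a ∷ b ∷ [])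
      collect : ∀ T z c L → T * (2 * T * (2 * L)) + z * (3 * (c * T) * (2 * L))
        ≡ T * (L * (4 * T + 6 * (z * c)))
      collect T z c L = solve (T ∷ z ∷ c ∷ L ∷ [])

  -- A bad t is one for which the lower bound for φ (d * (v + c * t)) fails.
  bad? : ∀ t → Dec (2 * φ (d * (v + c * t)) < v + c * t)
  bad? t = 2 * φ (d * (v + c * t)) <? v + c * t

  private
    bad-hits : ∀ t → t < T → 𝟙 (bad? t) * L ≤ 4 * ∑ (suc L) (λ e → 𝟙 (e ∣? M t) * g e)
    bad-hits t t<T with bad? t
    ... | no _    = z≤n
    ... | yes bad = begin
      1 * L          ≡⟨ *-identityˡ L ⟩
      v + c * T      ≤⟨ +-monoʳ-≤ v cT≤v ⟩
      v + v          ≤⟨ +-mono-≤ (m≤m+n v _) (m≤m+n v _) ⟩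
      M t + M t      ≤⟨ +-mono-≤ M≤2Σ M≤2Σ ⟩
      2 * S + 2 * S  ≡⟨ *-distribʳ-+ S 2 2 ⟨
      4 * S          ∎
      where
      open ≤-Reasoning
      S : ℕ
      S = ∑ (suc L) (λ e → 𝟙 (e ∣? M t) * g e)
      lower : M t ≤ φ (d * M t) + S
      lower = totient-lower D d (M t) L 0<d (<-≤-trans 0<v (m≤m+n v _))
        (+-monoʳ-≤ v (*-monoʳ-≤ c (<⇒≤ t<T))) (native t)
      M≤2Σ : M t ≤ 2 * S
      M≤2Σ = +-cancelˡ-≤ (M t) (M t) (2 * S) (begin
        M t + M t                  ≤⟨ +-mono-≤ lower lower ⟩
        (φ (d * M t) + S) + (φ (d * M t) + S) ≡⟨ double (φ (d * M t)) S ⟩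
        2 * φ (d * M t) + 2 * S    ≤⟨ +-monoˡ-≤ (2 * S) (<⇒≤ bad) ⟩
        M t + 2 * S                ∎)
        where
        double : ∀ a b → (a + b) + (a + b) ≡ 2 * a + 2 * b
        double a b = solve (a ∷ b ∷ [])

  -- For large z and much larger T, only a small proportion of the t are bad: by
  -- totient-lower a bad t requires many pairs of a foreign prime e dividing M t
  -- and an s < L with e dividing 1 + d s, and such pairs are rare on average.
  fewBad : z * ∑ T (λ t → 𝟙 (bad? t)) ≤ 16 * T + 24 * (z * c)
  fewBad = *-cancelˡ-≤ L {{>-nonZero 0<L}} (begin
    L * (z * ∑ T (λ t → 𝟙 (bad? t)))
      ≡⟨ rearrange L z _ ⟩
    z * (∑ T (λ t → 𝟙 (bad? t)) * L)
      ≡⟨ cong (z *_) (∑-*ʳ T L _) ⟨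
    z * ∑ T (λ t → 𝟙 (bad? t) * L)
      ≤⟨ *-monoʳ-≤ z (∑-mono T bad-hits) ⟩
    z * ∑ T (λ t → 4 * ∑ (suc L) (λ e → 𝟙 (e ∣? M t) * g e))
      ≡⟨ cong (z *_) (trans (∑-*ˡ T 4 _) (cong (4 *_) (trans (∑-swap T (suc L) _)
           (∑-cong (suc L) λ e → ∑-*ʳ T (g e) _)))) ⟩
    z * (4 * ∑ (suc L) (λ e → h e * g e))
      ≡⟨ trans (sym (*-assoc z 4 _)) (trans (cong (_* ∑ (suc L) (λ e → h e * g e)) (*-comm z 4)) (*-assoc 4 z _)) ⟩
    4 * (z * ∑ (suc L) (λ e → h e * g e))
      ≤⟨ *-monoʳ-≤ 4 pairs ⟩
    4 * (L * (4 * T + 6 * (z * c)))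
      ≡⟨ collect L T (z * c) ⟩
    L * (16 * T + 24 * (z * c)) ∎)
    where
    open ≤-Reasoning
    rearrange : ∀ a b c → a * (b * c) ≡ b * (c * a)
    rearrange a b c = solve (a ∷ b ∷ c ∷ [])
    collect : ∀ L T w → 4 * (L * (4 * T + 6 * w)) ≡ L * (16 * T + 24 * w)
    collect L T w = solve (L ∷ T ∷ w ∷ [])

-- Construction of the progression

-- A sequence of pairwise coprime numbers Q 0, Q 1, … coprime to N, whose
-- totient ratios decrease rapidly: φ(Q j)/Q j is at most the reciprocal of
-- 8 P j, where P j is N times the product of the preceding Q i.
module RapidSequence (N : ℕ) (0<N : 0 < N) where

  private
    P⁺ : ℕ → ∃[ n ] (0 < n)

    next : ∀ j → ∃[ Q ] (0 < Q × Coprime (proj₁ (P⁺ j)) Q × 8 * proj₁ (P⁺ j) * φ Q ≤ Q)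
    next j = smallTotientRatio (proj₁ (P⁺ j)) (8 * proj₁ (P⁺ j)) (proj₂ (P⁺ j))

    P⁺ zero    = N , 0<N
    P⁺ (suc j) = proj₁ (P⁺ j) * proj₁ (next j) , *-mono-≤ (proj₂ (P⁺ j)) (proj₁ (proj₂ (next j)))

  P Q : ℕ → ℕ
  P j = proj₁ (P⁺ j)
  Q j = proj₁ (next j)

  0<Q : ∀ j → 0 < Q j
  0<Q j = proj₁ (proj₂ (next j))

  P⊥Q : ∀ j → Coprime (P j) (Q j)
  P⊥Q j = proj₁ (proj₂ (proj₂ (next j)))

  Q-ratio : ∀ j → 8 * P j * φ (Q j) ≤ Q j
  Q-ratio j = proj₂ (proj₂ (proj₂ (next j)))

  P-mono-∣ : ∀ {a b} → a ≤ b → P a ∣ P b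
  P-mono-∣ a≤b = help (≤⇒≤′ a≤b)
    where
    help : ∀ {a b} → a ≤′ b → P a ∣ P b
    help ≤′-refl          = ∣-refl
    help (≤′-step {b} le) = ∣m⇒∣m*n (Q b) (help le)

  N∣P : ∀ j → N ∣ P j
  N∣P j = P-mono-∣ {0} {j} z≤n

  N⊥Q : ∀ j → Coprime N (Q j)
  N⊥Q j = coprime-∣ˡ (N∣P j) (P⊥Q j)

  Q⊥Q : ∀ {a b} → a < b → Coprime (Q a) (Q b)
  Q⊥Q {a} {b} a<b = coprime-∣ˡ (∣-trans (n∣m*n (P a)) (P-mono-∣ a<b)) (P⊥Q b)

  Q-rapid : ∀ {a b m} → a < b → m ∣ N → 8 * (m * Q a) * φ (Q b) ≤ Q b
  Q-rapid {a} {b} {m} a<b m∣N = ≤-trans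
    (*-monoˡ-≤ (φ (Q b)) (*-monoʳ-≤ 8 (∣⇒≤ {{>-nonZero (proj₂ (P⁺ b))}}
      (∣-trans (*-monoˡ-∣ (Q a) (∣-trans m∣N (N∣P a))) (P-mono-∣ a<b)))))
    (Q-ratio b)

-- A sequence that goes up from i to i + 1 when σ i holds and down otherwise, for
-- i < k, and whose terms up to index k are distinct: the i-th term is k + i or
-- k - i, so that each new term is larger, or smaller, than all the previous ones.
module Levels (k : ℕ) (σ : ℕ → Bool) where

  level : ℕ → ℕ
  level zero    = k
  level (suc i) = if σ i then k + suc i else k ∸ suc i

  level-distance : ∀ {i} → i ≤ k → ∣ level i - k ∣ ≡ i
  level-distance {zero}  _ = ∣n-n∣≡0 k
  level-distance {suc i} i<k with σ i
  ... | true  = trans (∣-∣-comm (k + suc i) k) (∣m-m+n∣≡n k (suc i))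
  ... | false = trans (m≤n⇒∣m-n∣≡n∸m (m∸n≤m k (suc i))) (m∸[m∸n]≡n i<k)

  level-injective : ∀ {i j} → i ≤ k → j ≤ k → level i ≡ level j → i ≡ j
  level-injective i≤k j≤k eq =
    trans (sym (level-distance i≤k)) (trans (cong (λ l → ∣ l - k ∣) eq) (level-distance j≤k))

  level≤ : ∀ i → level i ≤ k + i
  level≤ zero    = m≤m+n k 0
  level≤ (suc i) with σ i
  ... | true  = ≤-refl
  ... | false = ≤-trans (m∸n≤m k (suc i)) (m≤m+n k (suc i))

  level≥ : ∀ i → k ∸ i ≤ level i
  level≥ zero    = ≤-refl
  level≥ (suc i) with σ i
  ... | true  = ≤-trans (m∸n≤m k (suc i)) (m≤m+n k (suc i))
  ... | false = ≤-refl

  level-up : ∀ i → σ i ≡ true → level i < level (suc i)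
  level-up i eq rewrite eq = ≤-<-trans (level≤ i) (+-monoʳ-< k (n<1+n i))

  level-down : ∀ i → i < k → σ i ≡ false → level (suc i) < level i
  level-down i i<k eq rewrite eq = <-≤-trans (∸-monoʳ-< (n<1+n i) i<k) (level≥ i)

-- A progression n₀ + D t on which the pattern σ is frequent.  The number q i is
-- a divisor imposed on n + i + 1 in order to make its totient small, and d i is
-- the part of n + i + 1 composed of the primes dividing D, up to multiplicities.
record PatternProgression (k z : ℕ) (σ : ℕ → Bool) : Set where
  field
    D n₀ : ℕ
    q d  : ℕ → ℕ
    0<D  : 0 < D
    0<n₀ : 0 < n₀
    0<q  : ∀ i → 0 < q i
    0<d  : ∀ i → 0 < d i
    q∣D   : ∀ {i} → i < k → q i ∣ D
    q∣n₀+ : ∀ {i} → i < k → q i ∣ n₀ + suc i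
    d∣D   : ∀ {i} → i < k → d i ∣ D
    d∣n₀+ : ∀ {i} → i < k → d i ∣ n₀ + suc i
    smallPrimes∣D : ∀ {p} → Prime p → p ≤ z → p ∣ D
    -- The primes native to the modulus occur in n₀ + i + 1 only as factors of d i.
    native  : ∀ {i p} → i < k → Prime p → p ∣ n₀ + suc i → p ∣ D → p ∣ d i
    -- Where σ prescribes a descent, the ratio φ(q)/q at the second number is
    -- much smaller than 1/d at the first; for an ascent the other way round.
    q-above : ∀ {i} → suc i < k → σ i ≡ true  → 8 * d i * φ (q (suc i)) ≤ q (suc i)
    q-below : ∀ {i} → suc i < k → σ i ≡ false → 8 * d (suc i) * φ (q i) ≤ q i

-- The construction takes n divisible by z !, so that n + i + 1 has the same
-- primes up to z as i + 1, and imposes the divisors q i by the Chinese remainder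
-- theorem.
module _ (k z : ℕ) (k≤z : k ≤ z) (σ : ℕ → Bool) where

  private
    open Levels k σ
    open RapidSequence (z !) (1≤n! z)

    q : ℕ → ℕ
    q i = Q (level i)

    q-pairwise : ∀ {i j} → i < j → j < k → Coprime (q i) (q j)
    q-pairwise {i} {j} i<j j<k with <-cmp (level i) (level j)
    ... | tri< lt _ _ = Q⊥Q lt
    ... | tri> _ _ gt = Coprime.sym (Q⊥Q gt)
    ... | tri≈ _ eq _ = ⊥-elim (<⇒≢ i<j (level-injective (<⇒≤ (<-trans i<j j<k)) (<⇒≤ j<k) eq))

    D : ℕ
    D = z ! * ∏ k q

    0<D : 0 < D
    0<D = *-mono-≤ (1≤n! z) (0<∏ k λ i → 0<Q (level i))

    solution : ∃[ n ] (z ! ∣ n × (∀ i → i < k → q i ∣ n + suc i))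
    solution = chineseRemainder (z !) k q suc (λ i → 0<Q (level i)) (λ i → N⊥Q (level i)) q-pairwise

    n₀ : ℕ
    n₀ = D + proj₁ solution

    0<n₀ : 0 < n₀
    0<n₀ = <-≤-trans 0<D (m≤m+n D _)

    z!∣n₀ : z ! ∣ n₀
    z!∣n₀ = ∣m∣n⇒∣m+n (m∣m*n (∏ k q)) (proj₁ (proj₂ solution))

    q∣D : ∀ {i} → i < k → q i ∣ D
    q∣D i<k = ∣n⇒∣m*n (z !) (factor∣∏ q i<k)

    q∣n₀+ : ∀ {i} → i < k → q i ∣ n₀ + suc i
    q∣n₀+ {i} i<k = subst (q i ∣_) (sym (+-assoc D (proj₁ solution) (suc i)))
      (∣m∣n⇒∣m+n (q∣D i<k) (proj₂ (proj₂ solution) i i<k))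

    d : ℕ → ℕ
    d i = suc i * q i

    ∣z! : ∀ {m} → 0 < m → m ≤ z → m ∣ z !
    ∣z! {suc m} _ m≤z = ∣-trans (m∣m*n (m !)) (m≤n⇒m!∣n! m≤z)

    suc∣z! : ∀ {i} → i < k → suc i ∣ z !
    suc∣z! i<k = ∣z! (s≤s z≤n) (≤-trans i<k k≤z)

    0<d : ∀ i → 0 < d i
    0<d i = *-mono-≤ {1} {suc i} (s≤s z≤n) (0<Q (level i))

    d∣D : ∀ {i} → i < k → d i ∣ D
    d∣D i<k = *-pres-∣ (suc∣z! i<k) (factor∣∏ q i<k)

    d∣n₀+ : ∀ {i} → i < k → d i ∣ n₀ + suc i
    d∣n₀+ {i} i<k = coprime⇒*∣ (coprime-∣ˡ (suc∣z! i<k) (N⊥Q (level i)))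
      (∣m∣n⇒∣m+n (∣-trans (suc∣z! i<k) z!∣n₀) ∣-refl) (q∣n₀+ i<k)

    smallPrimes∣D : ∀ {p} → Prime p → p ≤ z → p ∣ D
    smallPrimes∣D pr p≤z =
      ∣m⇒∣m*n (∏ k q) (∣z! (>-nonZero⁻¹ _ {{prime⇒nonZero pr}}) p≤z)

    close : ∀ {p i j} → i < j → p ∣ n₀ + suc i → p ∣ n₀ + suc j → p ≤ j
    close {p} {i} {j} i<j p∣i p∣j = ≤-trans
      (∣⇒≤ {{>-nonZero (m<n⇒0<n∸m i<j)}} (∣m+n∣m⇒∣n (subst (p ∣_) eq p∣j) p∣i))
      (m∸n≤m j i)
      where
      eq : n₀ + suc j ≡ n₀ + suc i + (j ∸ i)
      eq = trans (cong (λ x → n₀ + suc x) (sym (m+[n∸m]≡n (<⇒≤ i<j)))) (sym (+-assoc n₀ (suc i) (j ∸ i)))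

    -- A prime factor of q j exceeds z, and so does not divide n₀ + i + 1 for
    -- any other i < k.
    native : ∀ {i p} → i < k → Prime p → p ∣ n₀ + suc i → p ∣ D → p ∣ d i
    native {i} {p} i<k pr p∣m p∣D with euclidsLemma (z !) (∏ k q) pr p∣D
    ... | inj₁ p∣z! = ∣m⇒∣m*n (q i) (∣m+n∣m⇒∣n p∣m (∣-trans p∣z! z!∣n₀))
    ... | inj₂ p∣Π with prime∣∏ k pr p∣Π
    ...   | j , j<k , p∣qj = case
      where
      large : p ≤ k → ∀ {A : Set} → A
      large p≤k = ⊥-elim (¬prime[1] (subst Prime (N⊥Q (level j)
        (∣z! (>-nonZero⁻¹ p {{prime⇒nonZero pr}}) (≤-trans p≤k k≤z) , p∣qj)) pr))
      p∣j : p ∣ n₀ + suc j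
      p∣j = ∣-trans p∣qj (q∣n₀+ j<k)
      case : p ∣ d i
      case with <-cmp i j
      ... | tri< i<j _ _ = large (≤-trans (close i<j p∣m p∣j) (<⇒≤ j<k))
      ... | tri> _ _ j<i = large (≤-trans (close j<i p∣j p∣m) (<⇒≤ i<k))
      ... | tri≈ _ refl _ = ∣n⇒∣m*n (suc i) p∣qj

    q-rapid : ∀ {i j} → i < k → level i < level j → 8 * d i * φ (q j) ≤ q j
    q-rapid i<k lt = Q-rapid lt (suc∣z! i<k)

  patternProgression : PatternProgression k z σ
  patternProgression = record
    { D = D ; n₀ = n₀ ; q = q ; d = d
    ; 0<D = 0<D ; 0<n₀ = 0<n₀ ; 0<q = λ i → 0<Q (level i) ; 0<d = 0<d
    ; q∣D = q∣D ; q∣n₀+ = q∣n₀+ ; d∣D = d∣D ; d∣n₀+ = d∣n₀+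
    ; smallPrimes∣D = smallPrimes∣D ; native = native
    ; q-above = λ {i} 1+i<k eq → q-rapid {i} {suc i} (<-trans (n<1+n i) 1+i<k) (level-up i eq)
    ; q-below = λ {i} 1+i<k eq → q-rapid {suc i} {i} 1+i<k (level-down i (<-trans (n<1+n i) 1+i<k) eq)
    }

-- Frequency of the pattern in the progression

-- Comparison of a number a satisfying φ(a)/a ≥ 1/(2d) with a number m of
-- comparable size having a divisor q of much smaller totient ratio.
φ-compare : ∀ {d a m q} → 0 < d → a ≤ 2 * d * φ a → 0 < m → m ≤ 2 * a →
  0 < q → q ∣ m → 8 * d * φ q ≤ q → φ m < φ a
φ-compare {d} {a} {m} {q} 0<d lower 0<m m≤2a 0<q q∣m ratio = ≰⇒> λ φa≤φm → <⇒≱ 0<m (begin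
  m              ≤⟨ m≤4dφa ⟩
  4 * d * φ a    ≡⟨ cong (4 * d *_) (φa≡0 φa≤φm) ⟩
  4 * d * 0      ≡⟨ *-zeroʳ (4 * d) ⟩
  0              ∎)
  where
  open ≤-Reasoning
  m≤4dφa : m ≤ 4 * d * φ a
  m≤4dφa = begin
    m                  ≤⟨ m≤2a ⟩
    2 * a              ≤⟨ *-monoʳ-≤ 2 lower ⟩
    2 * (2 * d * φ a)  ≡⟨ rearrange d (φ a) ⟩
    4 * d * φ a        ∎
    where
    rearrange : ∀ d f → 2 * (2 * d * f) ≡ 4 * d * f
    rearrange d f = solve (d ∷ f ∷ [])
  8dφm≤m : 8 * d * φ m ≤ m
  8dφm≤m = *-cancelʳ-≤ _ _ q {{>-nonZero 0<q}} (begin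
    8 * d * φ m * q     ≡⟨ *-assoc (8 * d) (φ m) q ⟩
    8 * d * (φ m * q)   ≤⟨ *-monoʳ-≤ (8 * d) (φ-∣ q∣m) ⟩
    8 * d * (φ q * m)   ≡⟨ *-assoc (8 * d) (φ q) m ⟨
    8 * d * φ q * m     ≤⟨ *-monoˡ-≤ m ratio ⟩
    q * m               ≡⟨ *-comm q m ⟩
    m * q               ∎)
  2φm≤φa : 2 * φ m ≤ φ a
  2φm≤φa = *-cancelˡ-≤ (4 * d) {{m*n≢0 4 d {{_}} {{>-nonZero 0<d}}}} (begin
    4 * d * (2 * φ m)   ≡⟨ rearrange d (φ m) ⟩
    8 * d * φ m         ≤⟨ 8dφm≤m ⟩
    m                   ≤⟨ m≤4dφa ⟩
    4 * d * φ a         ∎)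
    where
    rearrange : ∀ d f → 4 * d * (2 * f) ≡ 8 * d * f
    rearrange d f = solve (d ∷ f ∷ [])
  φa≡0 : φ a ≤ φ m → φ a ≡ 0
  φa≡0 φa≤φm = n≤0⇒n≡0 (+-cancelˡ-≤ (φ a) (φ a) 0 (begin
    φ a + φ a      ≤⟨ +-mono-≤ φa≤φm φa≤φm ⟩
    φ m + φ m      ≡⟨ cong (φ m +_) (+-identityʳ (φ m)) ⟨
    2 * φ m        ≤⟨ 2φm≤φa ⟩
    φ a            ≡⟨ +-identityʳ (φ a) ⟨
    φ a + 0        ∎))

module Frequency {k σ} (0<k : 0 < k) (progression : PatternProgression k (48 * k) σ) where

  -- This z makes φ(n + i + 1) too small for at most T / (2k) of the n in a window
  -- of length T, for each of the k values of i.
  z : ℕ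
  z = 48 * k

  open PatternProgression progression public

  -- The pattern prescribed by σ: for i + 1 < k, a true σ i asks for a descent from
  -- φ(n+i+1) to φ(n+i+2), and a false one for an ascent.
  Pattern : ℕ → Set
  Pattern n = ∀ i → suc i < k →
    (σ i ≡ true  → φ (n + suc (suc i)) < φ (n + suc i)) ×
    (σ i ≡ false → φ (n + suc i) < φ (n + suc (suc i)))

  -- From T₀ on, the constant terms in the estimates below are dominated by T.
  T₀ : ℕ
  T₀ = n₀ + k + 3 * (z * D)

  module _ (T : ℕ) (T₀≤T : T₀ ≤ T) where

    n₀+k≤T : n₀ + k ≤ T
    n₀+k≤T = ≤-trans (m≤m+n (n₀ + k) _) T₀≤T

    n₀≤T : n₀ ≤ T
    n₀≤T = ≤-trans (m≤m+n n₀ k) n₀+k≤T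

    0<T : 0 < T
    0<T = <-≤-trans 0<n₀ n₀≤T

    -- The progression from index T on; the members with t < T form the window.
    n : ℕ → ℕ
    n t = n₀ + D * (T + t)

    -- The numbers n t + i + 1 are d i times the terms v + c t of a progression.
    module Shift {i} (i<k : i < k) where

      u c v : ℕ
      u = quotient (d∣n₀+ i<k)
      c = quotient (d∣D i<k)
      v = u + c * T

      n+≡ : ∀ t → n t + suc i ≡ d i * (v + c * t)
      n+≡ t = begin
        n₀ + D * (T + t) + suc i
          ≡⟨ swap n₀ (D * (T + t)) (suc i) ⟩
        n₀ + suc i + D * (T + t)
          ≡⟨ cong₂ (λ x y → x + y * (T + t)) (_∣_.equality (d∣n₀+ i<k)) (_∣_.equality (d∣D i<k)) ⟩
        u * d i + c * d i * (T + t)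
          ≡⟨ factor u (d i) c T t ⟩
        d i * (u + c * T + c * t) ∎
        where
        open ≡-Reasoning
        swap : ∀ a b c → a + b + c ≡ a + c + b
        swap a b c = trans (+-assoc a b c) (trans (cong (a +_) (+-comm b c)) (sym (+-assoc a c b)))
        factor : ∀ u d c T t → u * d + c * d * (T + t) ≡ d * (u + c * T + c * t)
        factor u d c T t = solve (u ∷ d ∷ c ∷ T ∷ t ∷ [])

      0<c : 0 < c
      0<c = >-nonZero⁻¹ c {{quotient≢0 (d∣D i<k) {{>-nonZero 0<D}}}}

      c≤D : c ≤ D
      c≤D = ∣⇒≤ {{>-nonZero 0<D}} (quotient-∣ (d∣D i<k))

      u≤cT : u ≤ c * T
      u≤cT = begin
        u            ≤⟨ ∣⇒≤ {{>-nonZero (<-≤-trans 0<n₀ (m≤m+n n₀ (suc i)))}} (quotient-∣ (d∣n₀+ i<k)) ⟩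
        n₀ + suc i   ≤⟨ +-monoʳ-≤ n₀ i<k ⟩
        n₀ + k       ≤⟨ n₀+k≤T ⟩
        T            ≤⟨ m≤n*m T c {{>-nonZero 0<c}} ⟩
        c * T        ∎
        where open ≤-Reasoning

      native′ : ∀ t {p} → Prime p → p ∣ d i * (v + c * t) → p ∣ D → p ∣ d i
      native′ t {p} pr p∣m p∣D = native i<k pr p∣n₀+ p∣D
        where
        eq : n t + suc i ≡ D * (T + t) + (n₀ + suc i)
        eq = trans (cong (_+ suc i) (+-comm n₀ (D * (T + t)))) (+-assoc (D * (T + t)) n₀ (suc i))
        p∣n₀+ : p ∣ n₀ + suc i
        p∣n₀+ = ∣m+n∣m⇒∣n (subst (p ∣_) (trans (sym (n+≡ t)) eq) p∣m) (∣m⇒∣m*n (T + t) p∣D)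

      open Window (d∣D i<k) (quotient-∣ (d∣D i<k)) (0<d i) 0<c 0<T (m≤n+m (c * T) u)
        (≤-trans (+-monoˡ-≤ (c * T) u≤cT) (≤-reflexive (cong (c * T +_) (sym (+-identityʳ (c * T))))))
        smallPrimes∣D native′ public using (bad?; fewBad)

    -- The lower bound φ(n+i+1)/(n+i+1) ≥ 1/(2 d i) fails for n = n t.
    tooSmall? : ∀ i t → Dec (2 * d i * φ (n t + suc i) < n t + suc i)
    tooSmall? i t = 2 * d i * φ (n t + suc i) <? n t + suc i

    fewTooSmall : ∀ i → i < k → 2 * k * ∑ T (λ t → 𝟙 (tooSmall? i t)) ≤ T
    fewTooSmall i i<k = *-cancelˡ-≤ 24 (begin
      24 * (2 * k * ∑ T (λ t → 𝟙 (tooSmall? i t)))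
        ≡⟨ rearrange k _ ⟩
      z * ∑ T (λ t → 𝟙 (tooSmall? i t))
        ≤⟨ *-monoʳ-≤ z (∑-mono T λ t _ → 𝟙-mono (tooSmall? i t) (bad? t) (cancel t)) ⟩
      z * ∑ T (λ t → 𝟙 (bad? t))
        ≤⟨ fewBad ⟩
      16 * T + 24 * (z * c)
        ≡⟨ cong (16 * T +_) (*-assoc 8 3 (z * c)) ⟩
      16 * T + 8 * (3 * (z * c))
        ≤⟨ +-monoʳ-≤ (16 * T) (*-monoʳ-≤ 8 (*-monoʳ-≤ 3 (*-monoʳ-≤ z c≤D))) ⟩
      16 * T + 8 * (3 * (z * D))
        ≤⟨ +-monoʳ-≤ (16 * T) (*-monoʳ-≤ 8 (≤-trans (m≤n+m _ (n₀ + k)) T₀≤T)) ⟩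
      16 * T + 8 * T
        ≡⟨ *-distribʳ-+ T 16 8 ⟨
      24 * T ∎)
      where
      open ≤-Reasoning
      open Shift i<k
      rearrange : ∀ k b → 24 * (2 * k * b) ≡ 48 * k * b
      rearrange k b = solve (k ∷ b ∷ [])
      cancel : ∀ t → 2 * d i * φ (n t + suc i) < n t + suc i →
        2 * φ (d i * (v + c * t)) < v + c * t
      cancel t lt = *-cancelˡ-< (d i) _ _ (subst (λ m → d i * (2 * φ m) < m) (n+≡ t)
        (subst (_< n t + suc i) (swap (d i) (φ (n t + suc i))) lt))
        where
        swap : ∀ d f → 2 * d * f ≡ d * (2 * f)
        swap d f = solve (d ∷ f ∷ [])

    q∣n+ : ∀ {i} t → i < k → q i ∣ n t + suc i
    q∣n+ {i} t i<k = subst (q i ∣_) (sym (trans (cong (_+ suc i) (+-comm n₀ (D * (T + t)))) (+-assoc (D * (T + t)) n₀ (suc i))))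
      (∣m∣n⇒∣m+n (∣m⇒∣m*n (T + t) (q∣D i<k)) (q∣n₀+ i<k))

    pattern-holds : ∀ t → (∀ i → i < k → n t + suc i ≤ 2 * d i * φ (n t + suc i)) → Pattern (n t)
    pattern-holds t good i 1+i<k = up , down
      where
      i<k : i < k
      i<k = <-trans (n<1+n i) 1+i<k
      0<n+ : ∀ j → 0 < n t + suc j
      0<n+ j = ≤-trans (s≤s z≤n) (m≤n+m (suc j) (n t))
      next≤ : n t + suc (suc i) ≤ 2 * (n t + suc i)
      next≤ = ≤-trans (≤-reflexive (+-suc (n t) (suc i)))
        (+-mono-≤ {1} (0<n+ i) (m≤m+n (n t + suc i) 0))
      previous≤ : n t + suc i ≤ 2 * (n t + suc (suc i))
      previous≤ = ≤-trans (+-monoʳ-≤ (n t) (n≤1+n (suc i))) (m≤m+n _ _)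
      up : σ i ≡ true → φ (n t + suc (suc i)) < φ (n t + suc i)
      up eq = φ-compare (0<d i) (good i i<k) (0<n+ (suc i)) next≤ (0<q (suc i))
        (q∣n+ t 1+i<k) (q-above 1+i<k eq)
      down : σ i ≡ false → φ (n t + suc i) < φ (n t + suc (suc i))
      down eq = φ-compare (0<d (suc i)) (good (suc i) 1+i<k) (0<n+ i) previous≤ (0<q i)
        (q∣n+ t i<k) (q-below 1+i<k eq)

    module _ {S : Pred ℕ 0ℓ} (S? : Decidable S) (pattern⇒S : ∀ n → Pattern n → S n) where

      -- If no i < k is exceptional for t, then n t has the pattern.
      covered : ∀ t → 1 ≤ 𝟙 (S? (n t)) + ∑ k (λ i → 𝟙 (tooSmall? i t))
      covered t with ∑ k (λ i → 𝟙 (tooSmall? i t)) in eq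
      ... | suc b = ≤-trans (s≤s z≤n) (m≤n+m (suc b) _)
      ... | zero  = ≤-trans (≤-reflexive (sym (𝟙-yes (S? (n t)) (pattern⇒S (n t) (pattern-holds t good)))))
                            (m≤m+n _ 0)
        where
        good : ∀ i → i < k → n t + suc i ≤ 2 * d i * φ (n t + suc i)
        good i i<k = ≮⇒≥ λ small → <⇒≱ (n<1+n 0) (≤-trans (≤-reflexive (sym (𝟙-yes (tooSmall? i t) small)))
          (≤-trans (term≤∑ (λ i → 𝟙 (tooSmall? i t)) i<k) (≤-reflexive eq)))

      -- At least half of the T members n t with t < T belong to S, as the k sets
      -- of exceptions have at most T / (2k) elements each; all these members are
      -- at most 3 D T.
      frequent : T ≤ 2 * count S? (3 * D * T)
      frequent = *-cancelˡ-≤ k {{>-nonZero 0<k}} (+-cancelʳ-≤ (k * T) _ _ (begin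
        k * T + k * T
          ≡⟨ rearrange k T ⟩
        2 * k * T
          ≡⟨ cong (2 * k *_) (trans (∑-const T 1) (*-identityʳ T)) ⟨
        2 * k * ∑ T (λ _ → 1)
          ≤⟨ *-monoʳ-≤ (2 * k) (∑-mono T λ t _ → covered t) ⟩
        2 * k * ∑ T (λ t → 𝟙 (S? (n t)) + ∑ k (λ i → 𝟙 (tooSmall? i t)))
          ≡⟨ cong (2 * k *_) (trans (∑-+ T _ _) (cong (∑ T (λ t → 𝟙 (S? (n t))) +_) (∑-swap T k _))) ⟩
        2 * k * (∑ T (λ t → 𝟙 (S? (n t))) + ∑ k (λ i → ∑ T (λ t → 𝟙 (tooSmall? i t))))
          ≡⟨ *-distribˡ-+ (2 * k) (∑ T λ t → 𝟙 (S? (n t))) _ ⟩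
        2 * k * ∑ T (λ t → 𝟙 (S? (n t))) + 2 * k * ∑ k (λ i → ∑ T (λ t → 𝟙 (tooSmall? i t)))
          ≤⟨ +-mono-≤ (*-monoʳ-≤ (2 * k) counted) exceptions ⟩
        2 * k * count S? (3 * D * T) + k * T
          ≡⟨ cong (_+ k * T) (assoc k (count S? (3 * D * T))) ⟩
        k * (2 * count S? (3 * D * T)) + k * T ∎))
        where
        open ≤-Reasoning
        rearrange : ∀ k T → k * T + k * T ≡ 2 * k * T
        rearrange k T = solve (k ∷ T ∷ [])
        assoc : ∀ k c → 2 * k * c ≡ k * (2 * c)
        assoc k c = solve (k ∷ c ∷ [])
        exceptions : 2 * k * ∑ k (λ i → ∑ T (λ t → 𝟙 (tooSmall? i t))) ≤ k * T
        exceptions = begin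
          2 * k * ∑ k (λ i → ∑ T (λ t → 𝟙 (tooSmall? i t)))   ≡⟨ ∑-*ˡ k (2 * k) _ ⟨
          ∑ k (λ i → 2 * k * ∑ T (λ t → 𝟙 (tooSmall? i t)))   ≤⟨ ∑-mono k fewTooSmall ⟩
          ∑ k (λ _ → T)                                      ≡⟨ ∑-const k T ⟩
          k * T                                              ∎
        u : ℕ → ℕ
        u t = pred n₀ + D * (T + t)
        1+u≡n : ∀ t → suc (u t) ≡ n t
        1+u≡n t = cong (_+ D * (T + t)) (suc-pred n₀ {{>-nonZero 0<n₀}})
        n≤u : ∀ t → n t ≤ u (suc t)
        n≤u t = begin
          n t                                ≡⟨ 1+u≡n t ⟨
          suc (pred n₀ + D * (T + t))        ≡⟨ +-suc (pred n₀) _ ⟨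
          pred n₀ + (1 + D * (T + t))        ≤⟨ +-monoʳ-≤ (pred n₀) (+-monoˡ-≤ (D * (T + t)) 0<D) ⟩
          pred n₀ + (D + D * (T + t))        ≡⟨ cong (pred n₀ +_) (*-suc D (T + t)) ⟨
          pred n₀ + D * suc (T + t)          ≡⟨ cong (λ x → pred n₀ + D * x) (+-suc T t) ⟨
          u (suc t)                          ∎
        uT≤ : u T ≤ 3 * D * T
        uT≤ = begin
          pred n₀ + D * (T + T)    ≤⟨ +-monoˡ-≤ _ (≤-trans pred[n]≤n n₀≤T) ⟩
          T + D * (T + T)          ≤⟨ +-monoˡ-≤ _ (m≤n*m T D {{>-nonZero 0<D}}) ⟩
          D * T + D * (T + T)      ≡⟨ collect D T ⟩
          3 * D * T                ∎
          where
          collect : ∀ D T → D * T + D * (T + T) ≡ 3 * D * T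
          collect D T = solve (D ∷ T ∷ [])
        counted : ∑ T (λ t → 𝟙 (S? (n t))) ≤ count S? (3 * D * T)
        counted = ≤-trans (∑≤count S? u n (λ t → ≤-reflexive (1+u≡n t)) n≤u T) (count-mono S? uT≤)

-- Positive lower density

open import Data.Integer.Base using (+_)

/-≤-/ : ∀ a b m n .{{_ : NonZero m}} .{{_ : NonZero n}} → a * n ≤ b * m →
  + a ℚ./ m ℚ.≤ + b ℚ./ n
/-≤-/ a b m@(suc m-1) n@(suc n-1) le = ℚ.toℚᵘ-cancel-≤ (begin
  toℚᵘ (+ a ℚ./ m)   ≃⟨ ℚ.toℚᵘ-fromℚᵘ (mkℚᵘ (+ a) m-1) ⟩
  mkℚᵘ (+ a) m-1     ≤⟨ *≤* (ℤ.≤-trans (ℤ.≤-reflexive (sym (ℤ.pos-* a n)))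
                          (ℤ.≤-trans (ℤ.+≤+ le) (ℤ.≤-reflexive (ℤ.pos-* b m)))) ⟩
  mkℚᵘ (+ b) n-1     ≃⟨ ℚ.toℚᵘ-fromℚᵘ (mkℚᵘ (+ b) n-1) ⟨
  toℚᵘ (+ b ℚ./ n)   ∎)
  where open ℚᵘ.≤-Reasoning

0<1/ : ∀ m .{{_ : NonZero m}} → ℚ.0ℚ ℚ.< + 1 ℚ./ m
0<1/ m = ℚ.positive⁻¹ (+ 1 ℚ./ m) {{ℚ.normalize-pos 1 m}}

-- A set containing at least T/2 of the integers up to C T, for all large T,
-- has lower density at least 1/(4C) > 0.
positiveLowerDensity : {S : Pred ℕ 0ℓ} (S? : Decidable S) (C T₀ : ℕ) → 0 < C → 0 < T₀ →
  (∀ T → T₀ ≤ T → T ≤ 2 * count S? (C * T)) → HasPositiveLowerDensity S?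
positiveLowerDensity S? C T₀ 0<C 0<T₀ frequent =
  + 1 ℚ./ (4 * C) , 0<1/ (4 * C) , T₀ * C , λ x large →
    /-≤-/ 1 (count S? x) (4 * C) x (≤-trans (≤-reflexive (*-identityˡ x)) (dense x large))
  where
  open ≤-Reasoning
  instance
    C≢0 : NonZero C
    C≢0 = >-nonZero 0<C
    4C≢0 : NonZero (4 * C)
    4C≢0 = m*n≢0 4 C
  dense : ∀ x → T₀ * C ≤ x → x ≤ count S? x * (4 * C)
  dense x large = begin
    x                              ≡⟨ m≡m%n+[m/n]*n x C ⟩
    x % C + T * C                  ≤⟨ +-monoˡ-≤ (T * C) (≤-trans (<⇒≤ (m%n<n x C)) (m≤n*m C T {{>-nonZero 0<T}})) ⟩
    T * C + T * C                  ≤⟨ +-mono-≤ TC≤ TC≤ ⟩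
    2 * count S? x * C + 2 * count S? x * C ≡⟨ collect (count S? x) C ⟩
    count S? x * (4 * C)           ∎
    where
    T : ℕ
    T = x / C
    T₀≤T : T₀ ≤ T
    T₀≤T = ≤-trans (≤-reflexive (sym (m*n/n≡m T₀ C))) (/-monoˡ-≤ C large)
    0<T : 0 < T
    0<T = <-≤-trans 0<T₀ T₀≤T
    CT≤x : C * T ≤ x
    CT≤x = ≤-trans (≤-reflexive (*-comm C T)) (m/n*n≤m x C)
    TC≤ : T * C ≤ 2 * count S? x * C
    TC≤ = *-monoˡ-≤ C (≤-trans (frequent T T₀≤T) (*-monoʳ-≤ 2 (count-mono S? CT≤x)))
    collect : ∀ s C → 2 * s * C + 2 * s * C ≡ s * (4 * C)
    collect s C = solve (s ∷ C ∷ [])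

plus-positive : ∀ {ε a b} → ε ≡ 1ℤ → b < a → ε ℤ.* (+ a ℤ.- + b) ℤ.> 0ℤ
plus-positive {a = a} {b} refl b<a = subst (0ℤ ℤ.<_) (sym eq) (ℤ.+<+ (m<n⇒0<n∸m b<a))
  where
  eq : 1ℤ ℤ.* (+ a ℤ.- + b) ≡ + (a ∸ b)
  eq = trans (ℤ.*-identityˡ _) (trans (ℤ.m-n≡m⊖n a b) (ℤ.⊖-≥ (<⇒≤ b<a)))

minus-positive : ∀ {ε a b} → ε ≡ -1ℤ → a < b → ε ℤ.* (+ a ℤ.- + b) ℤ.> 0ℤ
minus-positive {a = a} {b} refl a<b = subst (0ℤ ℤ.<_) (sym eq) (ℤ.+<+ (m<n⇒0<n∸m a<b))
  where
  eq : -1ℤ ℤ.* (+ a ℤ.- + b) ≡ + (b ∸ a)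
  eq = trans (ℤ.-1*i≡-i _) (trans (cong ℤ.-_ (ℤ.m-n≡m⊖n a b))
    (trans (sym (ℤ.⊖-swap b a)) (ℤ.⊖-≥ (<⇒≤ a<b))))

1+<⇐<∸1 : ∀ {m} n → m < n ∸ 1 → suc m < n
1+<⇐<∸1 (suc n) m<n = s≤s m<n

module _ (k : ℕ) (ε : Fin (k ∸ 1) → ℤ) where

  private
    isPlus? : ∀ i → Dec (∃[ j ] (toℕ j ≡ i × ε j ≡ 1ℤ))
    isPlus? i = Fin.any? λ j → (toℕ j ≟ i) ×-dec (ε j ℤ.≟ 1ℤ)

  -- The sequence of signs as a Boolean sequence, true at the signs + 1 and
  -- false elsewhere, also beyond the last sign.
  plus : ℕ → Bool
  plus i = does (isPlus? i)

  plus-true : ∀ i → ε i ≡ 1ℤ → plus (toℕ i) ≡ true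
  plus-true i eq = dec-true (isPlus? (toℕ i)) (i , refl , eq)

  plus-false : ∀ i → ε i ≡ -1ℤ → plus (toℕ i) ≡ false
  plus-false i eq = dec-false (isPlus? (toℕ i)) λ (j , j≡i , eq′) →
    -1≢1 (trans (sym eq) (trans (cong ε (sym (Fin.toℕ-injective j≡i))) eq′))
    where
    -1≢1 : -1ℤ ≢ 1ℤ
    -1≢1 ()

  hasPattern : (∀ i → ε i ≡ -1ℤ ⊎ ε i ≡ 1ℤ) → ∀ n →
    (∀ i → suc i < k →
      (plus i ≡ true  → φ (n + suc (suc i)) < φ (n + suc i)) ×
      (plus i ≡ false → φ (n + suc i) < φ (n + suc (suc i)))) →
    HasPattern k ε n
  hasPattern signs n ordered i with signs i | ordered (toℕ i) (1+<⇐<∸1 k (Fin.toℕ<n i))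
  ... | inj₂ ε≡1  | fall , _ = plus-positive ε≡1 (fall (plus-true i ε≡1))
  ... | inj₁ ε≡-1 | _ , rise = minus-positive ε≡-1 (rise (plus-false i ε≡-1))

corollary2 : (k : ℕ) → 2 ≤ k →
    (ε : Fin (k ∸ 1) → ℤ) → (∀ i → ε i ≡ -1ℤ ⊎ ε i ≡ 1ℤ) →
    HasPositiveLowerDensity (hasPattern? k ε)
corollary2 k 2≤k ε signs =
  positiveLowerDensity (hasPattern? k ε) (3 * D) T₀ (*-mono-≤ {1} {3} (s≤s z≤n) 0<D)
    (<-≤-trans 0<n₀ (≤-trans (m≤m+n n₀ k) (m≤m+n (n₀ + k) _)))
    λ T T₀≤T → frequent T T₀≤T (hasPattern? k ε) (hasPattern k ε signs)
  where
  0<k : 0 < k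
  0<k = ≤-trans (s≤s z≤n) 2≤k
  open Frequency 0<k (patternProgression k (48 * k) (m≤n*m k 48) (plus k ε))
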